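{- Let $S\subset\mathbb{R}^2$ be the three-chain configuration of $n$ points described in the context. For every integer $k$ with $\lfloor n/3\rfloor\leq k\leq\lfloor 5n/12\rfloor-1$, $$E_k(S)=3\binom{k+2}{2}+3\binom{k-\frac{n}{3}+2}{2},$$ which matches, for $n$ divisible by $3$, the known lower bound $3\binom{k+2}{2}+\sum_{j=\lfloor n/3\rfloor}^{k}(3j-n+3)$ on the number of $(\leq k)$-edges of a planar set of $n$ points.
   Context: A $j$-edge of a finite set $S\subset\mathbb{R}^2$ is an oriented segment $\overrightarrow{pq}$ with $p,q\in S$ distinct such that exactly $j$ points of $S$ lie in the open half-plane to the right of its supporting line, oriented from $p$ to $q$. The number of $j$-edges is denoted $e_j(S)$, and $E_k(S)=\sum_{j=0}^{k}e_j(S)$ is the number of $(\leq k)$-edges of $S$. It was previously known that every set $S$ of $n$ points in the plane satisfies $E_k(S)\geq 3\binom{k+2}{2}+\sum_{j=\lfloor n/3\rfloor}^{k}(3j-n+3)$. The configuration $S$ has $n$ points ($n$ divisible by $12$, so that the sizes below are integers) and is composed of three rotationally symmetric chains, each one associated to a convex hull vertex of $S$, with the following properties (left and right are considered with respect to the corresponding convex hull vertex). (i) The first part of each chain is slightly convex to the right and contains $\frac{3n}{12}$ points, with a hole between the first $\frac{2n}{12}$ points (called subchain $A$) and the remaining $\frac{n}{12}$ points (called subchain $B$). (ii) Each chain is completed with a subchain $C$, composed of another $\frac{n}{12}$ points, slightly convex to the left. (iii) All the lines spanned by two points in $A\cup B$, oriented from the outermost to the innermost endpoint, leave to the right the next chain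 in counterclockwise order, and to the left both the points in $C$ and those in the remaining chain. (iv) All the lines spanned by two points in $C$ separate subchains $A$ and $B$; furthermore, when oriented from the outermost to the innermost endpoint, they leave to the right the two remaining subchains of type $C$. (v) The triangle defined by the innermost points of the chains of type $B$ contains all the chains of type $C$.
   Formalization: Condition (iv) is also required of lines through points of type C from different chains, which must separate A and B of one of these two chains; with (iv) only for two points of the same C the formula fails (n = 12 with E_4 = 51 instead of 48). -}

module Defs where

open import Algebra.Bundles using (CommutativeRing)
open import Algebra.Structures using (IsCommutativeRing)
open import Data.Fin.Base using (Fin; zero; suc; toℕ)
import Data.Fin.Base as Fin
open import Data.List.Base
  using (List; length; filter; cartesianProduct; concat; tabulate; map; upTo; _++_)
open import Data.List.Relation.Unary.All using (All)
import Data.List.Relation.Unary.Unique.Setoid as UniqueSetoid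
open import Data.Nat.Base as ℕ using (ℕ)
import Data.Nat.Properties as ℕₚ
open import Data.Nat.ListAction using (sum)
open import Data.Product.Base using (∃; _×_; _,_)
open import Data.Product.Relation.Binary.Pointwise.NonDependent using (×-decSetoid)
open import Data.Sum.Base using (_⊎_; [_,_]′)
open import Level using (_⊔_) renaming (suc to lsuc)
open import Relation.Binary.Bundles using (StrictTotalOrder; DecSetoid)
open import Relation.Binary.Core using (Rel)
open import Relation.Binary.PropositionalEquality.Core using (_≡_; _≢_)
open import Relation.Binary.Structures using (IsStrictTotalOrder)
open import Relation.Nullary.Decidable using (¬?; _×-dec_)
open import Relation.Nullary.Negation using (¬_)
open import Relation.Unary using (Decidable)

∑ : ℕ → ℕ → (ℕ → ℕ) → ℕ
∑ a b f = sum (map (λ i → f (a ℕ.+ i)) (upTo (ℕ.suc b ℕ.∸ a)))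

-- The plane is taken over an arbitrary ordered field with trichotomous order;
-- ℝ is the intended one.
record OrderedField c ℓ₁ ℓ₂ : Set (lsuc (c ⊔ ℓ₁ ⊔ ℓ₂)) where
  infix  8 -_
  infixl 7 _*_
  infixl 6 _+_
  infix  4 _≈_ _<_
  field
    Carrier            : Set c
    _≈_                : Rel Carrier ℓ₁
    _<_                : Rel Carrier ℓ₂
    _+_ _*_            : Carrier → Carrier → Carrier
    -_                 : Carrier → Carrier
    0# 1#              : Carrier
    isCommutativeRing  : IsCommutativeRing _≈_ _+_ _*_ -_ 0# 1#
    isStrictTotalOrder : IsStrictTotalOrder _≈_ _<_
    0<1                : 0# < 1#
    +-monoˡ-<          : ∀ z {x y} → x < y → x + z < y + z
    *-pos              : ∀ {x y} → 0# < x → 0# < y → 0# < x * y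
    inverse            : ∀ x → ¬ x ≈ 0# → ∃ λ y → x * y ≈ 1#

  commutativeRing : CommutativeRing c ℓ₁
  commutativeRing = record { isCommutativeRing = isCommutativeRing }

  strictTotalOrder : StrictTotalOrder c ℓ₁ ℓ₂
  strictTotalOrder = record { isStrictTotalOrder = isStrictTotalOrder }

  open IsStrictTotalOrder isStrictTotalOrder public using (_≟_; _<?_; compare)

  infixl 6 _-_
  _-_ : Carrier → Carrier → Carrier
  x - y = x + (- y)

module Plane {c ℓ₁ ℓ₂} (F : OrderedField c ℓ₁ ℓ₂) where

  open OrderedField F

  Point : Set c
  Point = Carrier × Carrier

  pointDecSetoid : DecSetoid c ℓ₁
  pointDecSetoid = ×-decSetoid decSetoid decSetoid
    where open StrictTotalOrder strictTotalOrder using (decSetoid)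

  open DecSetoid pointDecSetoid public
    using () renaming (_≈_ to _≈ₚ_; _≟_ to _≟ₚ_; setoid to pointSetoid)

  -- Twice the signed area of the triangle pqr, positive when pqr is
  -- counterclockwise.
  orient : Point → Point → Point → Carrier
  orient (px , py) (qx , qy) (rx , ry) =
    (qx - px) * (ry - py) - (qy - py) * (rx - px)

  -- r lies strictly to the left (right) of the line pq oriented from p to q.
  LeftOf RightOf : Point → Point → Point → Set ℓ₂
  LeftOf  p q r = 0# < orient p q r
  RightOf p q r = orient p q r < 0#

  rightOf? : ∀ p q → Decidable (RightOf p q)
  rightOf? p q r = orient p q r <? 0#

  -- A finite set of points is a list without repetitions.
  Distinct : List Point → Set (c ⊔ ℓ₁)
  Distinct = UniqueSetoid.Unique pointSetoid

  rightCount : List Point → Point → Point → ℕ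
  rightCount S p q = length (filter (rightOf? p q) S)

  IsEdge : ℕ → List Point → Point × Point → Set ℓ₁
  IsEdge j S (p , q) = (¬ p ≈ₚ q) × rightCount S p q ≡ j

  isEdge? : ∀ j S → Decidable (IsEdge j S)
  isEdge? j S (p , q) = ¬? (p ≟ₚ q) ×-dec (rightCount S p q ℕₚ.≟ j)

  e : ℕ → List Point → ℕ
  e j S = length (filter (isEdge? j S) (cartesianProduct S S))

  E : ℕ → List Point → ℕ
  E k S = ∑ 0 k (λ j → e j S)

  -- For p in S: some linear functional attains its minimum over S at p only,
  -- that is, {p} is a face of the convex hull of S.
  IsHullVertex : List Point → Point → Set (c ⊔ ℓ₁ ⊔ ℓ₂)
  IsHullVertex S (px , py) = ∃ λ ((ux , uy) : Point) →
    All (λ (qx , qy) → ¬ (qx , qy) ≈ₚ (px , py) →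
           0# < ux * (qx - px) + uy * (qy - py)) S

  -- x lies in the open triangle with vertices p, q, r.
  InTriangle : Point → Point → Point → Point → Set ℓ₂
  InTriangle p q r x =
    (LeftOf  p q x × LeftOf  q r x × LeftOf  r p x) ⊎
    (RightOf p q x × RightOf q r x × RightOf r p x)

  -- The cosine -1/2 and the sine √3/2 of the angle 2π/3.
  record ThirdTurn : Set (c ⊔ ℓ₁ ⊔ ℓ₂) where
    field
      cos sin   : Carrier
      cos+cos   : cos + cos ≈ - 1#
      0<sin     : 0# < sin
      cos²+sin² : cos * cos + sin * sin ≈ 1#

  rotate : ThirdTurn → Point → Point → Point
  rotate τ (ox , oy) (x , y) =
      ox + (cos * (x - ox) - sin * (y - oy))
    , oy + (sin * (x - ox) + cos * (y - oy))
    where open ThirdTurn τ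

  next : Fin 3 → Fin 3
  next zero             = suc zero
  next (suc zero)       = suc (suc zero)
  next (suc (suc zero)) = zero

  -- The configuration on n = 12 m points.  The points of each chain are
  -- enumerated from the outermost, the associated hull vertex, to the
  -- innermost; next i is the chain following i counterclockwise, so
  -- next (next i) is the remaining one.
  record ThreeChains (m : ℕ) : Set (c ⊔ ℓ₁ ⊔ ℓ₂) where
    field
      -- AB i enumerates A followed by B: the points of A are those of index
      -- below 2m.
      AB : Fin 3 → Fin (3 ℕ.* m) → Point
      C  : Fin 3 → Fin m → Point

    chain : Fin 3 → Fin (3 ℕ.* m) ⊎ Fin m → Point
    chain i = [ AB i , C i ]′

    points : List Point
    points = concat (tabulate λ i → tabulate (AB i) ++ tabulate (C i))

    -- The line pq has A on one side and B on the other, for the chain i.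
    SeparatesAB : Point → Point → Fin 3 → Set ℓ₂
    SeparatesAB p q i =
      (∀ r → (toℕ r ℕ.< 2 ℕ.* m → LeftOf  p q (AB i r)) ×
             (2 ℕ.* m ℕ.≤ toℕ r → RightOf p q (AB i r))) ⊎
      (∀ r → (toℕ r ℕ.< 2 ℕ.* m → RightOf p q (AB i r)) ×
             (2 ℕ.* m ℕ.≤ toℕ r → LeftOf  p q (AB i r)))

    field
      distinct : Distinct points

      turn      : ThirdTurn
      centre    : Point
      symmetric : ∀ i x → chain (next i) x ≈ₚ rotate turn centre (chain i x)

      hullVertex : ∀ i r → toℕ r ≡ 0 → IsHullVertex points (AB i r)

      -- A chain is convex to the right if it bends to the right when
      -- traversed inwards, and convex to the left if it bends to the left.
      AB-convexRight : ∀ i {r s t} → r Fin.< s → s Fin.< t →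
                       RightOf (AB i r) (AB i s) (AB i t)
      C-convexLeft   : ∀ i {r s t} → r Fin.< s → s Fin.< t →
                       LeftOf (C i r) (C i s) (C i t)

      AB-next      : ∀ i {r s} → r Fin.< s → ∀ x →
                     RightOf (AB i r) (AB i s) (chain (next i) x)
      AB-ownC      : ∀ i {r s} → r Fin.< s → ∀ t →
                     LeftOf (AB i r) (AB i s) (C i t)
      AB-remaining : ∀ i {r s} → r Fin.< s → ∀ x →
                     LeftOf (AB i r) (AB i s) (chain (next (next i)) x)

      -- This concerns every line through two points of type C.  For points of
      -- one chain (i ≡ j) it separates A and B of that chain; for points of
      -- different chains, A and B of one of these two chains.
      C-separates : ∀ i j r s → (i , r) ≢ (j , s) →
                    SeparatesAB (C i r) (C j s) i ⊎ SeparatesAB (C i r) (C j s) j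
      C-otherC    : ∀ i j → i ≢ j → ∀ {r s} → r Fin.< s → ∀ t →
                    RightOf (C i r) (C i s) (C j t)

      -- The index r with suc (toℕ r) ≡ 3 m is that of the innermost point
      -- of B.
      C-inside : ∀ r → ℕ.suc (toℕ r) ≡ 3 ℕ.* m → ∀ i t →
                 InTriangle (AB zero r) (AB (suc zero) r) (AB (suc (suc zero)) r)
                            (C i t)

{-# OPTIONS --safe #-}

-- Let n = 12m.  From a point p of A ∪ B in chain i, the next chain is seen on
-- the right and the other 5m points outside A ∪ B of chain i, the far points, on
-- the left of the lines within A ∪ B.  If p is the point of index r,
-- and q a far point of rank t in the angular order around p, then there are
-- r + t points to the right of the line qp, and 4m + (3m - 1 - r) + t to the
-- right of pq.  If q is instead a point of type C of the next chain, of rank t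
-- among these, there are 3m + r + t points to the right of pq, and at least 5m to
-- the right of qp.  A line through two points of type C separates A from B in
-- some chain, and this leaves at least 5m points on each side of it.  Hence, for
-- 4m ≤ k < 5m, the (≤k)-edges are counted by pairs (r , t) of natural numbers:
-- per chain, those with r < 3m and r + t ≤ k, those with t < m and
-- 3m + r + t ≤ k, and twice those with 4m + r + t ≤ k, since the lines within
-- A ∪ B also contribute the latter.  The total is C(k+2, 2) + C(k-4m+2, 2).
module Submission where

open import Algebra.Bundles using (CommutativeRing; RawRing)
open import Data.Bool.Base using (if_then_else_; true; false)
open import Data.Empty using (⊥-elim)
open import Data.Fin.Base as Fin
  using (Fin; zero; suc; toℕ; fromℕ; fromℕ<; opposite; punchOut; splitAt; _↑ˡ_; _↑ʳ_)
open import Data.Fin.Permutation using (Permutation′; permutation; reverse; _⟨$⟩ʳ_)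
import Data.Fin.Properties as Finₚ
open import Data.List.Base as List
  using (List; []; _∷_; _++_; length; filter; cartesianProduct; concat; tabulate; applyUpTo; upTo)
open import Data.List.Membership.Propositional using (_∈_)
open import Data.List.Membership.Propositional.Properties
  using (∈-concat⁺′; ∈-tabulate⁺; ∈-++⁺ˡ)
import Data.List.Properties as Listₚ
import Data.List.Relation.Unary.All as All
open import Data.Maybe.Base using (Maybe; just; nothing)
open import Data.Nat.Base as ℕ using (ℕ; zero; suc; z≤n; s≤s)
import Data.Nat.ListAction as ListAction
import Data.Nat.ListAction.Properties as ListActionₚ
import Data.Nat.Properties as ℕₚ
open import Data.Product.Base using (_×_; _,_; ∃; proj₁; proj₂)
open import Data.Sum.Base using (_⊎_; inj₁; inj₂; [_,_]′; swap)
open import Function.Base using (_∘_; id)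
open import Function.Definitions using (Injective)
open import Level using (Level; _⊔_)
open import Relation.Binary.Bundles using (StrictTotalOrder)
open import Relation.Binary.Definitions using (tri<; tri≈; tri>)
open import Relation.Binary.PropositionalEquality as ≡ using (_≡_; _≢_)
open import Relation.Nullary.Decidable
  using (Dec; yes; no; does; ¬?; _×-dec_; dec-true; dec-false)
open import Relation.Nullary.Negation using (¬_; contradiction)
open import Relation.Unary using (Decidable)
open import Defs

-- Coefficients of the ring solver: the pair (a , b) stands for a − b.
module DifferenceSolver {c ℓ} (R : CommutativeRing c ℓ) where

  open CommutativeRing R
  open import Algebra.Properties.Ring ring
  open import Algebra.Properties.Semiring.Mult semiring
    using (×-homo-+; ×1-homo-*; ×-congˡ) renaming (_×_ to _·_)
  open import Algebra.Properties.CommutativeSemigroup +-commutativeSemigroup using (interchange)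
  open import Algebra.Solver.Ring.AlmostCommutativeRing
  open import Relation.Binary.Reasoning.Setoid setoid

  -- The solver compares normal forms by computation, so that coefficients
  -- have to be kept canonical.
  reduce : ℕ × ℕ → ℕ × ℕ
  reduce (a , b) = a ℕ.∸ b , b ℕ.∸ a

  coefficients : RawRing _ _
  coefficients = record
    { Carrier = ℕ × ℕ
    ; _≈_ = _≡_
    ; _+_ = λ (a , b) (c , d) → reduce (a ℕ.+ c , b ℕ.+ d)
    ; _*_ = λ (a , b) (c , d) → reduce (a ℕ.* c ℕ.+ b ℕ.* d , a ℕ.* d ℕ.+ b ℕ.* c)
    ; -_  = λ (a , b) → b , a
    ; 0#  = 0 , 0
    ; 1#  = 1 , 0
    }

  ⟦_⟧ᵈ : ℕ × ℕ → Carrier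
  ⟦ a , b ⟧ᵈ = a · 1# - b · 1#

  sub-+ : ∀ w x y z → (w + y) - (x + z) ≈ (w - x) + (y - z)
  sub-+ w x y z = begin
    (w + y) - (x + z)       ≈⟨ +-congˡ (-‿+-comm x z) ⟨
    (w + y) + (- x + - z)   ≈⟨ interchange w y (- x) (- z) ⟩
    (w - x) + (y - z)       ∎

  ⟦⟧ᵈ-* : ∀ u v a b → (u · 1# - v · 1#) * (a · 1# - b · 1#)
                   ≈ (u ℕ.* a ℕ.+ v ℕ.* b) · 1# - (u ℕ.* b ℕ.+ v ℕ.* a) · 1#
  ⟦⟧ᵈ-* u v a b = begin
    (u′ - v′) * (a′ - b′)
      ≈⟨ x[y-z]≈xy-xz (u′ - v′) a′ b′ ⟩
    (u′ - v′) * a′ - (u′ - v′) * b′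
      ≈⟨ +-cong ([y-z]x≈yx-zx a′ u′ v′) (-‿cong ([y-z]x≈yx-zx b′ u′ v′)) ⟩
    (u′ * a′ - v′ * a′) - (u′ * b′ - v′ * b′)
      ≈⟨ +-congˡ (trans (⁻¹-anti-homo‿- (u′ * b′) (v′ * b′)) refl) ⟩
    (u′ * a′ - v′ * a′) + (v′ * b′ - u′ * b′)
      ≈⟨ sub-+ (u′ * a′) (v′ * a′) (v′ * b′) (u′ * b′) ⟨
    (u′ * a′ + v′ * b′) - (v′ * a′ + u′ * b′)
      ≈⟨ +-congˡ (-‿cong (+-comm _ _)) ⟩
    (u′ * a′ + v′ * b′) - (u′ * b′ + v′ * a′)
      ≈⟨ +-cong (hom u a v b) (-‿cong (hom u b v a)) ⟨
    (u ℕ.* a ℕ.+ v ℕ.* b) · 1# - (u ℕ.* b ℕ.+ v ℕ.* a) · 1# ∎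
    where
    u′ = u · 1#
    v′ = v · 1#
    a′ = a · 1#
    b′ = b · 1#
    hom : ∀ k l p q → (k ℕ.* l ℕ.+ p ℕ.* q) · 1# ≈ (k · 1#) * (l · 1#) + (p · 1#) * (q · 1#)
    hom k l p q = trans (×-homo-+ 1# (k ℕ.* l) (p ℕ.* q))
                        (+-cong (×1-homo-* k l) (×1-homo-* p q))

  -- The hypothesis is `a - b = c - d` with the subtractions moved across. Each difference is
  -- expanded by the other's subtrahend: then the minuends agree by hypothesis and the subtrahends
  -- by commutativity.
  ⟦⟧ᵈ-cong : ∀ a b c d → a ℕ.+ d ≡ c ℕ.+ b → ⟦ a , b ⟧ᵈ ≈ ⟦ c , d ⟧ᵈ
  ⟦⟧ᵈ-cong a b c d eq = trans (sym (shift a b d))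
    (trans (+-cong (×-congˡ eq) (-‿cong (×-congˡ (ℕₚ.+-comm b d)))) (shift c d b))
    where
    shift : ∀ x y z → ⟦ x ℕ.+ z , y ℕ.+ z ⟧ᵈ ≈ ⟦ x , y ⟧ᵈ
    shift x y z = begin
      ⟦ x ℕ.+ z , y ℕ.+ z ⟧ᵈ   ≈⟨ +-cong (×-homo-+ 1# x z) (-‿cong (×-homo-+ 1# y z)) ⟩
      (x · 1# + z · 1#) - (y · 1# + z · 1#) ≈⟨ sub-+ _ _ _ _ ⟩
      ⟦ x , y ⟧ᵈ + ⟦ z , z ⟧ᵈ  ≈⟨ +-congˡ (-‿inverseʳ _) ⟩
      ⟦ x , y ⟧ᵈ + 0#          ≈⟨ +-identityʳ _ ⟩
      ⟦ x , y ⟧ᵈ               ∎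

  reduce-correct : ∀ a b → ⟦ reduce (a , b) ⟧ᵈ ≈ ⟦ a , b ⟧ᵈ
  reduce-correct a b = ⟦⟧ᵈ-cong (a ℕ.∸ b) (b ℕ.∸ a) a b
    (m∸n+n≡m+[n∸m] a b)
    where
    m∸n+n≡m+[n∸m] : ∀ m n → m ℕ.∸ n ℕ.+ n ≡ m ℕ.+ (n ℕ.∸ m)
    m∸n+n≡m+[n∸m] zero    zero    = ≡.refl
    m∸n+n≡m+[n∸m] zero    (suc n) = ≡.refl
    m∸n+n≡m+[n∸m] (suc m) zero    = ≡.refl
    m∸n+n≡m+[n∸m] (suc m) (suc n) =
      ≡.trans (ℕₚ.+-suc (m ℕ.∸ n) n) (≡.cong suc (m∸n+n≡m+[n∸m] m n))

  morphism : coefficients -Raw-AlmostCommutative⟶ fromCommutativeRing R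
  morphism = record
    { ⟦_⟧    = ⟦_⟧ᵈ
    ; +-homo = λ (a , b) (c , d) →
        trans (reduce-correct (a ℕ.+ c) (b ℕ.+ d))
          (trans (+-cong (×-homo-+ 1# a c) (-‿cong (×-homo-+ 1# b d))) (sub-+ _ _ _ _))
    ; *-homo = λ (a , b) (c , d) →
        trans (reduce-correct (a ℕ.* c ℕ.+ b ℕ.* d) (a ℕ.* d ℕ.+ b ℕ.* c))
          (sym (⟦⟧ᵈ-* a b c d))
    ; -‿homo = λ (a , b) → sym (⁻¹-anti-homo‿- _ _)
    ; 0-homo = -‿inverseʳ _
    ; 1-homo = trans (+-cong (+-identityʳ 1#) -0#≈0#) (+-identityʳ 1#)
    }

  coeff≟ : ∀ x y → Maybe (⟦ x ⟧ᵈ ≈ ⟦ y ⟧ᵈ)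
  coeff≟ (a , b) (c , d) with a ℕ.+ d ℕₚ.≟ c ℕ.+ b
  ... | yes eq = just (⟦⟧ᵈ-cong a b c d eq)
  ... | no  _  = nothing

  open import Algebra.Solver.Ring coefficients (fromCommutativeRing R) morphism coeff≟ public

-- Orientations of triples of points

module Orientation {c ℓ₁ ℓ₂} (F : OrderedField c ℓ₁ ℓ₂) where

  open OrderedField F
  open Plane F
  open CommutativeRing commutativeRing hiding (Carrier; _≈_; _+_; _*_; -_; _-_; 0#; 1#)
  open DifferenceSolver commutativeRing
  open StrictTotalOrder strictTotalOrder using (<-respˡ-≈; <-respʳ-≈; irrefl; asym)
    renaming (trans to <-trans)

  +-pos : ∀ {x y} → 0# < x → 0# < y → 0# < x + y
  +-pos {x} {y} 0<x 0<y =
    <-trans 0<y (<-respˡ-≈ (+-identityˡ y) (+-monoˡ-< y 0<x))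

  neg⇒-pos : ∀ {x} → x < 0# → 0# < - x
  neg⇒-pos {x} x<0 =
    <-respˡ-≈ (-‿inverseʳ x) (<-respʳ-≈ (+-identityˡ (- x)) (+-monoˡ-< (- x) x<0))

  -pos⇒neg : ∀ {x} → 0# < - x → x < 0#
  -pos⇒neg {x} 0<-x =
    <-respˡ-≈ (+-identityˡ x) (<-respʳ-≈ (-‿inverseˡ x) (+-monoˡ-< x 0<-x))

  *-cancelˡ-pos : ∀ {x y} → 0# < x → 0# < x * y → 0# < y
  *-cancelˡ-pos {x} {y} 0<x 0<xy with compare 0# y
  ... | tri< 0<y _ _ = 0<y
  ... | tri≈ _ 0≈y _ = contradiction 0<xy
    (irrefl (trans (sym (zeroʳ x)) (*-congˡ 0≈y)))
  ... | tri> _ _ y<0 = contradiction 0<xy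
    (asym (-pos⇒neg (<-respʳ-≈ x*-y≈-[xy] (*-pos 0<x (neg⇒-pos y<0)))))
    where
    x*-y≈-[xy] : x * (- y) ≈ - (x * y)
    x*-y≈-[xy] = solve 2 (λ x y → x :* (:- y) := :- (x :* y)) refl x y

  -- Common shape of the sign arguments below: in a three-term relation, five positive factors force
  -- the sixth to be positive.
  factor-pos : ∀ {u v w x y z} → u * v ≈ w * x + y * z →
               0# < u → 0# < w → 0# < x → 0# < y → 0# < z → 0# < v
  factor-pos eq 0<u 0<w 0<x 0<y 0<z = *-cancelˡ-pos 0<u
    (<-respʳ-≈ (sym eq) (+-pos (*-pos 0<w 0<x) (*-pos 0<y 0<z)))

  private
    Expr : ℕ → Set
    Expr n = Polynomial n × Polynomial n

    det : ∀ {n} → Expr n → Expr n → Expr n → Polynomial n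
    det (px , py) (qx , qy) (rx , ry) =
      (qx :- px) :* (ry :- py) :- (qy :- py) :* (rx :- px)

  orient-cyclic : ∀ p q r → orient p q r ≈ orient q r p
  orient-cyclic (px , py) (qx , qy) (rx , ry) = solve 6
    (λ px py qx qy rx ry → let p = px , py; q = qx , qy; r = rx , ry in
      det p q r := det q r p)
    refl px py qx qy rx ry

  orient-swap : ∀ p q r → orient p q r ≈ - orient q p r
  orient-swap (px , py) (qx , qy) (rx , ry) = solve 6
    (λ px py qx qy rx ry → let p = px , py; q = qx , qy; r = rx , ry in
      det p q r := :- det q p r)
    refl px py qx qy rx ry

  orient-add : ∀ p q r x → orient p q r ≈ orient p q x + orient q r x + orient r p x
  orient-add (px , py) (qx , qy) (rx , ry) (xx , xy) = solve 8
    (λ px py qx qy rx ry xx xy →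
      let p = px , py; q = qx , qy; r = rx , ry; x = xx , xy in
      det p q r := det p q x :+ det q r x :+ det r p x)
    refl px py qx qy rx ry xx xy

  -- The three-term Grassmann-Plücker relation for the vectors from `p` to `a`, `b`, `c`, `d`, with
  -- the signs arranged so that no subtraction occurs.
  orient-plücker : ∀ p a b c d → orient p a b * orient p c d
                   ≈ orient p a c * orient p b d + orient p a d * orient p c b
  orient-plücker (px , py) (ax , ay) (bx , by) (cx , cy) (dx , dy) = solve 10
    (λ px py ax ay bx by cx cy dx dy →
      let p = px , py; a = ax , ay; b = bx , by; c = cx , cy; d = dx , dy in
      det p a b :* det p c d := det p a c :* det p b d :+ det p a d :* det p c b)
    refl px py ax ay bx by cx cy dx dy

  -- The two changes of sign cancel. This turns the terms of the Plücker relation into products of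
  -- orientations known to be positive.
  orient-flip : ∀ p a b c d → orient p a b * orient p c d ≈ orient p b a * orient p d c
  orient-flip (px , py) (ax , ay) (bx , by) (cx , cy) (dx , dy) = solve 10
    (λ px py ax ay bx by cx cy dx dy →
      let p = px , py; a = ax , ay; b = bx , by; c = cx , cy; d = dx , dy in
      det p a b :* det p c d := det p b a :* det p d c)
    refl px py ax ay bx by cx cy dx dy

  reflect : Point → Point → Point
  reflect (px , py) (tx , ty) = px + (px - tx) , py + (py - ty)

  orient-reflect : ∀ p t x → orient p (reflect p t) x ≈ orient t p x
  orient-reflect (px , py) (tx , ty) (xx , xy) = solve 6
    (λ px py tx ty xx xy → let p = px , py; t = tx , ty; x = xx , xy in
      det p (px :+ (px :- tx) , py :+ (py :- ty)) x := det t p x)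
    refl px py tx ty xx xy

  orient-degenerate : ∀ p q → orient p q q ≈ 0#
  orient-degenerate p q = trans (+-congˡ (-‿cong (*-comm _ _))) (-‿inverseʳ _)

  orient-congʳ : ∀ p q {r s} → r ≈ₚ s → orient p q r ≈ orient p q s
  orient-congʳ p q (rx≈sx , ry≈sy) =
    +-cong (*-congˡ (+-congʳ ry≈sy)) (-‿cong (*-congˡ (+-congʳ rx≈sx)))

  rotateˡ : ∀ {p q r} → LeftOf p q r → LeftOf q r p
  rotateˡ {p} {q} {r} = <-respʳ-≈ (orient-cyclic p q r)

  rotateʳ : ∀ {p q r} → LeftOf p q r → LeftOf r p q
  rotateʳ pqr = rotateˡ (rotateˡ pqr)

  right⇒left : ∀ {p q r} → RightOf p q r → LeftOf q p r
  right⇒left {p} {q} {r} pqr = <-respʳ-≈ (sym (orient-swap q p r)) (neg⇒-pos pqr)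

  left⇒right : ∀ {p q r} → LeftOf q p r → RightOf p q r
  left⇒right {p} {q} {r} qpr = -pos⇒neg (<-respʳ-≈ (orient-swap q p r) qpr)

  left-asym : ∀ {p q r} → LeftOf p q r → ¬ LeftOf q p r
  left-asym pqr qpr = asym pqr (left⇒right qpr)

  left⇒≉ : ∀ {p q r} → LeftOf p q r → ¬ q ≈ₚ r
  left⇒≉ {p} {q} pqr q≈r =
    irrefl (sym (trans (sym (orient-congʳ p q q≈r)) (orient-degenerate p q))) pqr

  left-interior : ∀ {p q r} x → LeftOf p q x → LeftOf q r x → LeftOf r p x → LeftOf p q r
  left-interior {p} {q} {r} x pqx qrx rpx =
    <-respʳ-≈ (sym (orient-add p q r x)) (+-pos (+-pos pqx qrx) rpx)

  -- The angular order around `p` is cyclic on the whole plane, but transitive on the open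
  -- half-plane to the left of `pu`.
  left-transˡ : ∀ {p u x y z} → LeftOf p u x → LeftOf p u y → LeftOf p u z →
                LeftOf p x y → LeftOf p y z → LeftOf p x z
  left-transˡ {p} {u} {x} {y} {z} ux uy uz xy yz =
    factor-pos (orient-plücker p u y x z) uy ux yz uz xy

  -- The same on the opposite half-plane, to the right of `pu`.
  left-transʳ : ∀ {p u x y z} → LeftOf p x u → LeftOf p y u → LeftOf p z u →
                LeftOf p x y → LeftOf p y z → LeftOf p x z
  left-transʳ {p} {u} {x} {y} {z} xu yu zu xy yz =
    factor-pos (trans (orient-plücker p y u x z) (+-congʳ (orient-flip p y x u z)))
      yu xy zu yz xu

  -- `y` lies in the convex cone with apex `p` spanned by `x` and `z`, and the half-plane to the
  -- left of `pu` contains both, hence the cone.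
  left-between : ∀ {p u x y z} → LeftOf p u x → LeftOf p u z → LeftOf p x z →
                 LeftOf p x y → LeftOf p y z → LeftOf p u y
  left-between {p} {u} {x} {y} {z} ux uz xz xy yz =
    factor-pos (trans (orient-plücker p x z u y) (+-congʳ (orient-flip p x u z y)))
      xz ux yz xy uz

  -- Here and in the next lemma p lies inside the triangle abc.
  left-oppositeˡ : ∀ {p a b c x} → LeftOf p a b → LeftOf p b c → LeftOf p c a →
                   LeftOf p a x → LeftOf p b x → LeftOf p x c
  left-oppositeˡ {p} {a} {b} {c} {x} ab bc ca ax bx =
    factor-pos (trans (orient-plücker p a b x c) (+-congˡ (orient-flip p a c x b)))
      ab ax bc ca bx

  left-oppositeʳ : ∀ {p a b c x} → LeftOf p a b → LeftOf p b c → LeftOf p c a →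
                   LeftOf p x a → LeftOf p x b → LeftOf p c x
  left-oppositeʳ {p} {a} {b} {c} {x} ab bc ca xa xb =
    factor-pos (trans (orient-plücker p a b c x)
        (+-cong (orient-flip p a c b x) (orient-flip p a x c b)))
      ab ca xb xa bc

  -- Hull vertices and interior points

  displacement : Point → Point → Point → Carrier
  displacement (ux , uy) (px , py) (qx , qy) = ux * (qx - px) + uy * (qy - py)

  -- Up to a common factor, the areas of `bcp`, `cap` and `abp` are the barycentric coordinates of
  -- `p` in `abc`. A linear functional measured from `p` therefore has weighted sum zero over the
  -- vertices.
  displacement-barycentric : ∀ u p a b c →
    orient b c p * displacement u p a + orient c a p * displacement u p b
      ≈ - (orient a b p * displacement u p c)
  displacement-barycentric (ux , uy) (px , py) (ax , ay) (bx , by) (cx , cy) = solve 10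
    (λ ux uy px py ax ay bx by cx cy →
      let p = px , py; a = ax , ay; b = bx , by; c = cx , cy
          φ = λ (qx , qy) → ux :* (qx :- px) :+ uy :* (qy :- py) in
      det b c p :* φ a :+ det c a p :* φ b := :- (det a b p :* φ c))
    refl ux uy px py ax ay bx by cx cy

  -- A functional minimal at `p` only is positive at the three vertices when measured from `p`, so
  -- that its sum with positive weights cannot vanish.
  interior⇒¬hullVertex : ∀ {S p a b c} → a ∈ S → b ∈ S → c ∈ S →
                         LeftOf a b p → LeftOf b c p → LeftOf c a p → ¬ IsHullVertex S p
  interior⇒¬hullVertex {p = p} {a} {b} {c} a∈S b∈S c∈S abp bcp cap (u , supports) =
    asym (*-pos abp (0<φ c∈S (left⇒≉ bcp)))
      (-pos⇒neg (<-respʳ-≈ (displacement-barycentric u p a b c)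
        (+-pos (*-pos bcp (0<φ a∈S (left⇒≉ cap))) (*-pos cap (0<φ b∈S (left⇒≉ abp))))))
    where
    0<φ : ∀ {q} → q ∈ _ → ¬ q ≈ₚ p → 0# < displacement u p q
    0<φ q∈S = All.lookup supports q∈S

-- The relative position of the chains

module Configuration {c ℓ₁ ℓ₂} (F : OrderedField c ℓ₁ ℓ₂) (m′ : ℕ)
                     (S : Plane.ThreeChains F (suc m′)) where

  open OrderedField F using (compare; 0#)
  open Plane F
  open Orientation F
  open ThreeChains S
  open StrictTotalOrder (OrderedField.strictTotalOrder F) using (<-respˡ-≈; <-respʳ-≈; module Eq)

  private
    m = suc m′

  -- A relation is used beside `next` because `next (next (next i))` does not reduce to `i` for a
  -- variable `i`, whereas rotating a triple is a case distinction.
  data Cyclic : Fin 3 → Fin 3 → Fin 3 → Set where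
    cyc₀ : Cyclic zero (suc zero) (suc (suc zero))
    cyc₁ : Cyclic (suc zero) (suc (suc zero)) zero
    cyc₂ : Cyclic (suc (suc zero)) zero (suc zero)

  shift : ∀ {i j k} → Cyclic i j k → Cyclic j k i
  shift cyc₀ = cyc₁
  shift cyc₁ = cyc₂
  shift cyc₂ = cyc₀

  cyclic-next : ∀ i → Cyclic i (next i) (next (next i))
  cyclic-next zero             = cyc₀
  cyclic-next (suc zero)       = cyc₁
  cyclic-next (suc (suc zero)) = cyc₂

  right-next : ∀ {i j k} → Cyclic i j k → ∀ {r s} → r Fin.< s → ∀ x →
               LeftOf (AB i s) (AB i r) (chain j x)
  right-next cyc₀ r<s x = right⇒left (AB-next _ r<s x)
  right-next cyc₁ r<s x = right⇒left (AB-next _ r<s x)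
  right-next cyc₂ r<s x = right⇒left (AB-next _ r<s x)

  left-remaining : ∀ {i j k} → Cyclic i j k → ∀ {r s} → r Fin.< s → ∀ x →
                   LeftOf (AB i r) (AB i s) (chain k x)
  left-remaining cyc₀ r<s x = AB-remaining _ r<s x
  left-remaining cyc₁ r<s x = AB-remaining _ r<s x
  left-remaining cyc₂ r<s x = AB-remaining _ r<s x

  last : Fin (3 ℕ.* m)
  last = fromℕ _

  innermost : Fin 3 → Point
  innermost i = AB i last

  suc-last : suc (toℕ last) ≡ 3 ℕ.* m
  suc-last = ≡.cong suc (Finₚ.toℕ-fromℕ _)

  last-or-< : ∀ r → r ≡ last ⊎ r Fin.< last
  last-or-< r with Finₚ.<-cmp r last
  ... | tri< r<l _ _ = inj₂ r<l
  ... | tri≈ _ r≡l _ = inj₁ r≡l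
  ... | tri> _ _ l<r = contradiction (Finₚ.≤fromℕ r) (ℕₚ.<⇒≱ l<r)

  0<last : Fin._<_ {3 ℕ.* m} {3 ℕ.* m} zero last
  0<last = ≡.subst (0 ℕ.<_) (≡.sym (Finₚ.toℕ-fromℕ _))
             (ℕₚ.≤-trans (s≤s z≤n) (ℕₚ.m≤n+m _ m′))

  AB∈points : ∀ i r → AB i r ∈ points
  AB∈points i r = ∈-concat⁺′ (∈-++⁺ˡ (∈-tabulate⁺ {f = AB i} r))
    (∈-tabulate⁺ {f = λ l → tabulate (AB l) ++ tabulate (C l)} i)

  -- `C-inside` leaves the orientation of the innermost triangle open. If it were clockwise, the
  -- hull vertex `a₁` of the second chain would lie inside this triangle.
  left-innermost : LeftOf (innermost zero) (innermost (suc zero)) (innermost (suc (suc zero)))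
  left-innermost with C-inside last suc-last zero zero
  ... | inj₁ (b₀b₁x , b₁b₂x , b₂b₀x) = left-interior _ b₀b₁x b₁b₂x b₂b₀x
  ... | inj₂ (b₀b₁x , b₁b₂x , b₂b₀x) =
    contradiction (hullVertex (suc zero) zero ≡.refl)
      (interior⇒¬hullVertex (AB∈points (suc zero) last) (AB∈points zero last)
        (AB∈points (suc (suc zero)) last) b₁b₀a₁ b₀b₂a₁ b₂b₁a₁)
    where
    b₁b₀b₂ : LeftOf (innermost (suc zero)) (innermost zero) (innermost (suc (suc zero)))
    b₁b₀b₂ = left-interior _ (right⇒left b₀b₁x) (right⇒left b₂b₀x) (right⇒left b₁b₂x)
    b₂b₁a₁ : LeftOf (innermost (suc (suc zero))) (innermost (suc zero)) (AB (suc zero) zero)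
    b₂b₁a₁ = rotateʳ (right-next cyc₁ 0<last (inj₁ last))
    b₁b₀a₁ : LeftOf (innermost (suc zero)) (innermost zero) (AB (suc zero) zero)
    b₁b₀a₁ = rotateˡ (left-remaining cyc₁ 0<last (inj₁ last))
    -- Among the directions from `b₀` to the right of `b₀b₁`, the hull vertex of the first chain
    -- lies between `b₂` and `a₁`.
    b₀b₂a₁ : LeftOf (innermost zero) (innermost (suc (suc zero))) (AB (suc zero) zero)
    b₀b₂a₁ = left-transʳ (rotateˡ b₁b₀b₂) (right-next cyc₀ 0<last (inj₁ last)) (rotateˡ b₁b₀a₁)
               (rotateˡ (left-remaining cyc₀ 0<last (inj₁ last)))
               (right-next cyc₀ {zero} {last} 0<last (inj₁ zero))

  innermost-ccw : ∀ {i j k} → Cyclic i j k → LeftOf (innermost i) (innermost j) (innermost k)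
  innermost-ccw cyc₀ = left-innermost
  innermost-ccw cyc₁ = rotateˡ left-innermost
  innermost-ccw cyc₂ = rotateʳ left-innermost

  C-inner : ∀ {i j k} → Cyclic i j k → ∀ l t → LeftOf (innermost i) (innermost j) (C l t)
  C-inner σ l t with C-inside last suc-last l t
  ... | inj₂ (b₀b₁x , b₁b₂x , b₂b₀x) =
    contradiction (left-interior _ (right⇒left b₀b₁x) (right⇒left b₂b₀x) (right⇒left b₁b₂x))
      (left-asym left-innermost)
  ... | inj₁ (b₀b₁x , b₁b₂x , b₂b₀x) with σ
  ...   | cyc₀ = b₀b₁x
  ...   | cyc₁ = b₁b₂x
  ...   | cyc₂ = b₂b₀x

  -- The innermost point of chain `i` lies inside the triangle formed by `AB i r` and the other two
  -- innermost points.
  AB-behind : ∀ {i j k} → Cyclic i j k → ∀ {r} → r Fin.< last →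
              LeftOf (innermost j) (innermost k) (AB i r)
  AB-behind σ r<l = left-interior _ (rotateˡ (innermost-ccw σ))
    (rotateʳ (left-remaining σ r<l (inj₁ last)))
    (rotateˡ (right-next σ r<l (inj₁ last)))

  -- The case of two innermost points is `C-inner`; from there the ends of the line are moved
  -- outwards one at a time. Around the end that stays fixed, the innermost point of the other chain
  -- lies between the moved point and `C l t`, all three within a half-plane.
  AB-AB-C : ∀ {i j k} → Cyclic i j k → ∀ r s l t → LeftOf (AB i r) (AB j s) (C l t)
  AB-AB-C {i} {j} {k} σ r s l t = cases (last-or-< r) (last-or-< s)
    where
    from-outer : ∀ {i j k} → Cyclic i j k → ∀ {r} → r Fin.< last →
                 LeftOf (AB i r) (innermost j) (C l t)
    from-outer σ r<l = rotateʳ (left-transˡ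
      (C-inner (shift σ) l t) (rotateˡ (innermost-ccw σ)) (AB-behind σ r<l)
      (rotateˡ (C-inner σ l t)) (rotateʳ (right-next σ r<l (inj₁ last))))

    to-outer : ∀ {i j k} → Cyclic i j k → ∀ {s} → s Fin.< last →
               LeftOf (innermost i) (AB j s) (C l t)
    to-outer {i} {j} {k} σ {s} s<l = left-transʳ
      b₀pb₂ (innermost-ccw σ) (rotateˡ (C-inner (shift (shift σ)) l t))
      b₀pb₁ (C-inner σ l t)
      where
      b₀pb₁ : LeftOf (innermost i) (AB j s) (innermost j)
      b₀pb₁ = rotateʳ (left-remaining (shift σ) s<l (inj₁ last))
      b₀pb₂ : LeftOf (innermost i) (AB j s) (innermost k)
      b₀pb₂ = left-interior (innermost j) b₀pb₁
        (rotateˡ (right-next (shift σ) s<l (inj₁ last)))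
        (rotateʳ (innermost-ccw σ))

    cases : r ≡ last ⊎ r Fin.< last → s ≡ last ⊎ s Fin.< last →
            LeftOf (AB i r) (AB j s) (C l t)
    cases (inj₁ ≡.refl) (inj₁ ≡.refl) = C-inner σ l t
    cases (inj₁ ≡.refl) (inj₂ s<l)  = to-outer σ s<l
    cases (inj₂ r<l)  (inj₁ ≡.refl) = from-outer σ r<l
    cases (inj₂ r<l)  (inj₂ s<l)  = left-transʳ
      pp′b₂ (rotateʳ (AB-behind σ r<l)) (rotateˡ (to-outer (shift (shift σ)) r<l))
      pp′b₁ (from-outer σ r<l)
      where
      pp′b₁ : LeftOf (AB i r) (AB j s) (innermost j)
      pp′b₁ = rotateʳ (left-remaining (shift σ) s<l (inj₁ r))
      pp′b₂ : LeftOf (AB i r) (AB j s) (innermost k)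
      pp′b₂ = left-interior (innermost j) pp′b₁
        (rotateˡ (right-next (shift σ) s<l (inj₁ last)))
        (rotateˡ (AB-behind σ r<l))

  AB-AB-AB : ∀ {i j k} → Cyclic i j k → ∀ r s t → LeftOf (AB i r) (AB j s) (AB k t)
  AB-AB-AB σ r s t = left-interior (C zero zero) (AB-AB-C σ r s zero zero)
    (AB-AB-C (shift σ) s t zero zero) (AB-AB-C (shift (shift σ)) t r zero zero)

  -- A ray from a point of `A ∪ B` that separates the next chain from the far points. Keeping its
  -- tip as a witness confines the exceptional role of the innermost point to the construction of
  -- the ray.
  record Axis {i j k} (σ : Cyclic i j k) (r : Fin (3 ℕ.* m)) : Set (c ⊔ ℓ₂) where
    field
      tip            : Point
      next-right     : ∀ x → LeftOf (AB i r) (chain j x) tip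
      own-left       : ∀ t → LeftOf (AB i r) tip (C i t)
      remaining-left : ∀ x → LeftOf (AB i r) tip (chain k x)

  axis : ∀ {i j k} (σ : Cyclic i j k) r → Axis σ r
  axis {i} σ r with last-or-< r
  ... | inj₂ r<l = record
    { tip            = innermost i
    ; next-right     = λ x → rotateˡ (right-next σ r<l x)
    ; own-left       = λ t → AB-ownC i r<l t
    ; remaining-left = left-remaining σ r<l
    }
  -- No point of A ∪ B follows the innermost one, whose lines are extended backwards.
  ... | inj₁ ≡.refl = record
    { tip            = reflect (AB i last) (AB i zero)
    ; next-right     = λ x → rotateˡ (right⇒left (<-respˡ-≈
        (Eq.sym (orient-reflect (AB i last) (AB i zero) _)) (left⇒right (right-next σ 0<last x))))
    ; own-left       = λ t → <-respʳ-≈ (Eq.sym (orient-reflect (AB i last) (AB i zero) _))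
        (AB-ownC i 0<last t)
    ; remaining-left = λ x → <-respʳ-≈ (Eq.sym (orient-reflect (AB i last) (AB i zero) _))
        (left-remaining σ 0<last x)
    }

  -- Among the directions to the left of the line from `AB i r` to the innermost point of the next
  -- chain, the axis comes after `C j s` and before `C i t`.
  AB-C-own : ∀ {i j k} → Cyclic i j k → ∀ r s t → LeftOf (AB i r) (C j s) (C i t)
  AB-C-own {i} {j} σ r s t = left-transˡ
    (AB-AB-C σ r last _ _) (next-right (inj₁ last)) (AB-AB-C σ r last _ _)
    (next-right (inj₂ s)) (own-left t)
    where open Axis (axis σ r)

  AB-C-remaining : ∀ {i j k} → Cyclic i j k → ∀ r s t → LeftOf (AB i r) (C j s) (C k t)
  AB-C-remaining {i} {j} σ r s t = left-transˡ
    (AB-AB-C σ r last _ _) (next-right (inj₁ last)) (AB-AB-C σ r last _ _)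
    (next-right (inj₂ s)) (remaining-left (inj₂ t))
    where open Axis (axis σ r)

  -- Lines through two points of type C

  position : ∀ {i j k} → Cyclic i j k → ∀ l → l ≡ i ⊎ l ≡ j ⊎ l ≡ k
  position cyc₀ zero             = inj₁ ≡.refl
  position cyc₀ (suc zero)       = inj₂ (inj₁ ≡.refl)
  position cyc₀ (suc (suc zero)) = inj₂ (inj₂ ≡.refl)
  position cyc₁ zero             = inj₂ (inj₂ ≡.refl)
  position cyc₁ (suc zero)       = inj₁ ≡.refl
  position cyc₁ (suc (suc zero)) = inj₂ (inj₁ ≡.refl)
  position cyc₂ zero             = inj₂ (inj₁ ≡.refl)
  position cyc₂ (suc zero)       = inj₂ (inj₂ ≡.refl)
  position cyc₂ (suc (suc zero)) = inj₁ ≡.refl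

  -- The line is directed so that `A` of the separated chain `s` is on its left. The record places
  -- just enough points to have `5m` on each side; the points of type `C` in the chains `s` and `k`
  -- are not placed.
  record Separation (n d : Point) : Set (c ⊔ ℓ₂) where
    field
      {s j k}        : Fin 3
      cyclic         : Cyclic s j k
      outer-left     : ∀ t → toℕ t ℕ.< 2 ℕ.* m → LeftOf n d (AB s t)
      inner-right    : ∀ t → 2 ℕ.* m ℕ.≤ toℕ t → LeftOf d n (AB s t)
      next-right     : ∀ x → LeftOf d n (chain j x)
      remaining-left : ∀ t → LeftOf n d (AB k t)

  -- Let `a` and `b` be the outermost and innermost points of `A ∪ B` in chain `s`. Then `n` lies
  -- inside the triangle `abd`. Hence what `n` sees to the left of both `a` and `b` is to the right
  -- of `nd`, which applies to the next chain, and what it sees to the right of both is to the left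
  -- of `nd`, which applies to `A ∪ B` of the remaining one.
  separate : ∀ {s j k} → Cyclic s j k → ∀ l q l′ q′ → l ≡ s ⊎ l′ ≡ s →
             (∀ t → toℕ t ℕ.< 2 ℕ.* m → LeftOf (C l q) (C l′ q′) (AB s t)) →
             (∀ t → 2 ℕ.* m ℕ.≤ toℕ t → LeftOf (C l′ q′) (C l q) (AB s t)) →
             Separation (C l q) (C l′ q′)
  separate {s} {j} {k} σ l q l′ q′ l≡s⊎l′≡s outer inner = record
    { cyclic         = σ
    ; outer-left     = outer
    ; inner-right    = inner
    ; next-right     = λ
        { (inj₁ t) → right (AB-AB-C σ zero t l q) (AB-AB-C σ last t l q)
        ; (inj₂ t) → right (next-C-before σ zero t l q abn) (next-C-before σ last t l q abn)
        }
    ; remaining-left = λ t → left-oppositeʳ nab (rotateˡ dnb) nda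
        (rotateʳ (AB-AB-C σ′ t zero l q)) (rotateʳ (AB-AB-C σ′ t last l q))
    }
    where
    n = C l q
    d = C l′ q′
    a = AB s zero
    b = AB s last
    σ′ = shift (shift σ)

    nda : LeftOf n d a
    nda = outer zero (s≤s z≤n)

    dnb : LeftOf d n b
    dnb = inner last (≡.subst (2 ℕ.* m ℕ.≤_) (≡.sym (Finₚ.toℕ-fromℕ _)) (ℕₚ.m≤n+m _ m′))

    side : ∀ l t → LeftOf a b (C l t) ⊎ LeftOf b a (C l t)
    side l t with position σ l
    ... | inj₁ ≡.refl        = inj₁ (AB-ownC s 0<last t)
    ... | inj₂ (inj₁ ≡.refl) = inj₂ (right-next σ 0<last (inj₂ t))
    ... | inj₂ (inj₂ ≡.refl) = inj₁ (left-remaining σ 0<last (inj₂ t))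

    -- The segment nd cannot cross ab, since a lies beyond the vertex b of the
    -- triangle that contains n and d.
    abd⇒abn : LeftOf a b d → LeftOf a b n
    abd⇒abn abd with side l q
    ... | inj₁ abn = abn
    ... | inj₂ ban = contradiction (right-next σ 0<last (inj₁ last))
      (left-asym (rotateʳ (left-between (C-inner σ l′ q′) (C-inner σ l q)
        (rotateʳ dnb) (rotateˡ abd) ban)))

    left-own : ∀ {l} t → l ≡ s → LeftOf a b (C l t)
    left-own t ≡.refl = AB-ownC s 0<last t

    abn : LeftOf a b n
    abn = [ left-own q , (λ l′≡s → abd⇒abn (left-own q′ l′≡s)) ]′ l≡s⊎l′≡s

    nab : LeftOf n a b
    nab = rotateʳ abn

    -- A point to the left of `ab` is not in the next chain, so the angular order around the points
    -- of chain `s` puts it after every `C j t`.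
    next-C-before : ∀ {s j k} → Cyclic s j k → ∀ r t l q →
                    LeftOf (AB s zero) (AB s last) (C l q) →
                    LeftOf (AB s r) (C j t) (C l q)
    next-C-before σ r t l q abx with position σ l
    ... | inj₁ ≡.refl        = AB-C-own σ r t q
    ... | inj₂ (inj₁ ≡.refl) = contradiction (right-next σ 0<last (inj₂ q)) (left-asym abx)
    ... | inj₂ (inj₂ ≡.refl) = AB-C-remaining σ r t q

    right : ∀ {x} → LeftOf a x n → LeftOf b x n → LeftOf d n x
    right axn bxn = rotateʳ (left-oppositeˡ nab (rotateˡ dnb) nda (rotateʳ axn) (rotateʳ bxn))

  -- In the two cases with `A` on the right, the line is reversed.
  C-C-separation : ∀ l q l′ q′ → (l , q) ≢ (l′ , q′) →
                   Separation (C l q) (C l′ q′) ⊎ Separation (C l′ q′) (C l q)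
  C-C-separation l q l′ q′ distinct′ with C-separates l l′ q q′ distinct′
  ... | inj₁ (inj₁ AB-sides) = inj₁ (separate (cyclic-next l) l q l′ q′ (inj₁ ≡.refl)
          (λ t → proj₁ (AB-sides t)) (λ t 2m≤t → right⇒left (proj₂ (AB-sides t) 2m≤t)))
  ... | inj₁ (inj₂ AB-sides) = inj₂ (separate (cyclic-next l) l′ q′ l q (inj₂ ≡.refl)
          (λ t t<2m → right⇒left (proj₁ (AB-sides t) t<2m)) (λ t → proj₂ (AB-sides t)))
  ... | inj₂ (inj₁ AB-sides) = inj₁ (separate (cyclic-next l′) l q l′ q′ (inj₂ ≡.refl)
          (λ t → proj₁ (AB-sides t)) (λ t 2m≤t → right⇒left (proj₂ (AB-sides t) 2m≤t)))
  ... | inj₂ (inj₂ AB-sides) = inj₂ (separate (cyclic-next l′) l′ q′ l q (inj₁ ≡.refl)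
          (λ t t<2m → right⇒left (proj₁ (AB-sides t) t<2m)) (λ t → proj₂ (AB-sides t)))

  -- A separation puts all points of type `A` and `B` strictly on one side or the other. None is
  -- thus collinear with two points of type `C`, which makes the angular orders used below total.
  Separation⇒∉ : ∀ {n d} → Separation n d → ∀ i r →
                 LeftOf (AB i r) n d ⊎ LeftOf (AB i r) d n
  Separation⇒∉ sep i r with position (Separation.cyclic sep) i
  ... | inj₂ (inj₁ ≡.refl) = inj₂ (rotateʳ (Separation.next-right sep (inj₁ r)))
  ... | inj₂ (inj₂ ≡.refl) = inj₁ (rotateʳ (Separation.remaining-left sep r))
  ... | inj₁ ≡.refl with toℕ r ℕₚ.<? 2 ℕ.* m
  ...   | yes r<2m = inj₁ (rotateʳ (Separation.outer-left sep r r<2m))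
  ...   | no  r≮2m = inj₂ (rotateʳ (Separation.inner-right sep r (ℕₚ.≮⇒≥ r≮2m)))

  AB∉C-C : ∀ i r l q l′ q′ → (l , q) ≢ (l′ , q′) →
           LeftOf (AB i r) (C l q) (C l′ q′) ⊎ LeftOf (AB i r) (C l′ q′) (C l q)
  AB∉C-C i r l q l′ q′ distinct′ with C-C-separation l q l′ q′ distinct′
  ... | inj₁ sep = Separation⇒∉ sep i r
  ... | inj₂ sep = swap (Separation⇒∉ sep i r)

open import Data.Nat.Base hiding (ℕ; zero; suc; z≤n; s≤s; _⊔_; compare)
open import Data.Nat.Combinatorics using (_C_; nC1≡n; nCk+nC[k+1]≡[n+1]C[k+1])
open import Data.Nat.Divisibility using (_∣_; divides)
open import Data.Nat.DivMod using (m*n/n≡m)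
open import Data.Nat.Properties
open import Data.Nat.Solver using (module +-*-Solver)
open import Relation.Binary.PropositionalEquality hiding (_≡_; _≢_)
open import Algebra.Properties.Semiring.Sum +-*-semiring

-- Finite sums and counting

module Counting where

  private variable
    a p q : Level
    A B : Set a
    P : Set p
    Q : Set q
    m n : ℕ

  𝟙 : Dec P → ℕ
  𝟙 P? = if does P? then 1 else 0

  𝟙-true : (P? : Dec P) → P → 𝟙 P? ≡ 1
  𝟙-true P? x rewrite dec-true P? x = refl

  𝟙-false : (P? : Dec P) → ¬ P → 𝟙 P? ≡ 0
  𝟙-false P? ¬x rewrite dec-false P? ¬x = refl

  𝟙≤1 : (P? : Dec P) → 𝟙 P? ≤ 1
  𝟙≤1 P? with does P?
  ... | true  = ≤-refl
  ... | false = z≤n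

  𝟙-cong : (P? : Dec P) (Q? : Dec Q) → (P → Q) → (Q → P) → 𝟙 P? ≡ 𝟙 Q?
  𝟙-cong (yes x) Q? P⇒Q Q⇒P = sym (𝟙-true Q? (P⇒Q x))
  𝟙-cong (no ¬x) Q? P⇒Q Q⇒P = sym (𝟙-false Q? (¬x ∘ Q⇒P))

  𝟙-mono : (P? : Dec P) (Q? : Dec Q) → (P → Q) → 𝟙 P? ≤ 𝟙 Q?
  𝟙-mono (yes x) Q? P⇒Q = ≤-reflexive (sym (𝟙-true Q? (P⇒Q x)))
  𝟙-mono (no ¬x) Q? P⇒Q = z≤n

  listSum : (A → ℕ) → List A → ℕ
  listSum f xs = ListAction.sum (List.map f xs)

  length-filter : {P : A → Set p} (P? : Decidable P) → ∀ xs →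
                  length (filter P? xs) ≡ listSum (λ x → 𝟙 (P? x)) xs
  length-filter P? []       = refl
  length-filter P? (x ∷ xs) with does (P? x)
  ... | true  = cong suc (length-filter P? xs)
  ... | false = length-filter P? xs

  listSum-cong : {f g : A → ℕ} → f ≗ g → ∀ xs → listSum f xs ≡ listSum g xs
  listSum-cong f≗g xs = cong ListAction.sum (Listₚ.map-cong f≗g xs)

  listSum-++ : ∀ (f : A → ℕ) xs ys → listSum f (xs ++ ys) ≡ listSum f xs + listSum f ys
  listSum-++ f xs ys = trans (cong ListAction.sum (Listₚ.map-++ f xs ys))
    (ListActionₚ.sum-++ (List.map f xs) _)

  listSum-+ : ∀ (f g : A → ℕ) xs → listSum (λ x → f x + g x) xs ≡ listSum f xs + listSum g xs
  listSum-+ f g []       = refl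
  listSum-+ f g (x ∷ xs) = trans (cong (f x + g x +_) (listSum-+ f g xs))
    (+-interchange (f x) (g x) (listSum f xs) (listSum g xs))
    where open import Algebra.Properties.CommutativeSemigroup +-commutativeSemigroup
            renaming (interchange to +-interchange)

  listSum-0 : ∀ (xs : List A) → listSum (λ _ → 0) xs ≡ 0
  listSum-0 []       = refl
  listSum-0 (x ∷ xs) = listSum-0 xs

  listSum-comm : ∀ (f : A → B → ℕ) xs ys →
                 listSum (λ x → listSum (f x) ys) xs ≡ listSum (λ y → listSum (λ x → f x y) xs) ys
  listSum-comm f []       ys = sym (listSum-0 ys)
  listSum-comm f (x ∷ xs) ys = trans (cong (listSum (f x) ys +_) (listSum-comm f xs ys))
    (sym (listSum-+ (f x) _ ys))

  listSum-tabulate : ∀ (f : A → ℕ) (g : Fin n → A) → listSum f (tabulate g) ≡ sum (f ∘ g)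
  listSum-tabulate {n = zero}  f g = refl
  listSum-tabulate {n = suc n} f g = cong (f (g zero) +_) (listSum-tabulate f (g ∘ suc))

  listSum-applyUpTo : ∀ (f : A → ℕ) (g : ℕ → A) n →
                      listSum f (applyUpTo g n) ≡ ∑[ i < n ] f (g (toℕ i))
  listSum-applyUpTo f g zero    = refl
  listSum-applyUpTo f g (suc n) = cong (f (g 0) +_) (listSum-applyUpTo f (g ∘ suc) n)

  listSum-concat : ∀ (f : A → ℕ) (g : Fin n → List A) →
                   listSum f (concat (tabulate g)) ≡ ∑[ i < n ] listSum f (g i)
  listSum-concat {n = zero}  f g = refl
  listSum-concat {n = suc n} f g = trans (listSum-++ f (g zero) _)
    (cong (listSum f (g zero) +_) (listSum-concat f (g ∘ suc)))

  listSum-cartesianProduct : ∀ (f : A × B → ℕ) xs ys →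
    listSum f (cartesianProduct xs ys) ≡ listSum (λ x → listSum (λ y → f (x , y)) ys) xs
  listSum-cartesianProduct f []       ys = refl
  listSum-cartesianProduct f (x ∷ xs) ys = trans (listSum-++ f (List.map (x ,_) ys) _)
    (cong₂ _+_ (cong ListAction.sum (sym (Listₚ.map-∘ ys))) (listSum-cartesianProduct f xs ys))

  sum-0 : ∀ {f : Fin n → ℕ} → (∀ i → f i ≡ 0) → sum f ≡ 0
  sum-0 {n} f≗0 = trans (sum-cong-≗ f≗0) (sum-replicate-zero n)

  sum-1 : ∀ {f : Fin n → ℕ} → (∀ i → f i ≡ 1) → sum f ≡ n
  sum-1 {zero}  f≗1 = refl
  sum-1 {suc n} f≗1 = cong₂ _+_ (f≗1 zero) (sum-1 (f≗1 ∘ suc))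

  sum-mono-≤ : ∀ {f g : Fin n → ℕ} → (∀ i → f i ≤ g i) → sum f ≤ sum g
  sum-mono-≤ {zero}  f≤g = z≤n
  sum-mono-≤ {suc n} f≤g = +-mono-≤ (f≤g zero) (sum-mono-≤ (f≤g ∘ suc))

  sum-mono-< : ∀ {f g : Fin n → ℕ} → (∀ i → f i ≤ g i) → ∀ i → f i < g i → sum f < sum g
  sum-mono-< f≤g zero    f<g = +-mono-<-≤ f<g (sum-mono-≤ (f≤g ∘ suc))
  sum-mono-< f≤g (suc i) f<g = +-mono-≤-< (f≤g zero) (sum-mono-< (f≤g ∘ suc) i f<g)

  sum-split : ∀ m {n} (f : Fin (m + n) → ℕ) → sum f ≡ sum (f ∘ (_↑ˡ n)) + sum (f ∘ (m ↑ʳ_))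
  sum-split zero    f = refl
  sum-split (suc m) f = trans (cong (f zero +_) (sum-split m (f ∘ suc)))
    (sym (+-assoc (f zero) _ _))

  ∑-opposite : ∀ (f : Fin n → ℕ) → ∑[ i < n ] f (opposite i) ≡ sum f
  ∑-opposite f = sym (sum-permute f reverse)

  -- Pigeonhole: punching the missed value out of the codomain would give an injection into a
  -- smaller set.
  missing⇒¬injective : (f : Fin n → Fin n) → ∀ y → (∀ x → y ≢ f x) → ¬ Injective _≡_ _≡_ f
  missing⇒¬injective {suc n} f y y∉f injective =
    contradiction (Finₚ.injective⇒≤ {f = λ x → punchOut (y∉f x)}
        (injective ∘ Finₚ.punchOut-injective (y∉f _) (y∉f _)))
      (<⇒≱ (n<1+n n))

  injective⇒permutation : (f : Fin n → Fin n) → Injective _≡_ _≡_ f →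
                          ∃ λ (π : Permutation′ n) → ∀ x → π ⟨$⟩ʳ x ≡ f x
  injective⇒permutation {n} f injective =
    permutation f f⁻¹ (proj₂ ∘ preimage) (λ x → injective (proj₂ (preimage (f x)))) , λ _ → refl
    where
    preimage : ∀ y → ∃ λ x → f x ≡ y
    preimage y with Finₚ.any? (λ x → f x Finₚ.≟ y)
    ... | yes hit = hit
    ... | no miss = ⊥-elim (missing⇒¬injective f y (λ x y≡fx → miss (x , sym y≡fx)) injective)
    f⁻¹ : Fin n → Fin n
    f⁻¹ y = proj₁ (preimage y)

  module Rank {ℓ} {_≺_ : Fin n → Fin n → Set ℓ} (_≺?_ : ∀ x y → Dec (x ≺ y))
              (≺-irrefl : ∀ x → ¬ x ≺ x) (≺-trans : ∀ {x y z} → x ≺ y → y ≺ z → x ≺ z)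
              (≺-total : ∀ {x y} → x ≢ y → x ≺ y ⊎ y ≺ x) where

    rank : Fin n → ℕ
    rank x = ∑[ y < n ] 𝟙 (y ≺? x)

    rank<n : ∀ x → rank x < n
    rank<n x = subst (rank x <_) (sum-1 {n} (λ _ → refl))
      (sum-mono-< (λ y → 𝟙≤1 (y ≺? x)) x (s≤s (≤-reflexive (𝟙-false (x ≺? x) (≺-irrefl x)))))

    rank-mono : ∀ {x y} → x ≺ y → rank x < rank y
    rank-mono {x} {y} x≺y = sum-mono-< (λ z → 𝟙-mono (z ≺? x) (z ≺? y) (λ z≺x → ≺-trans z≺x x≺y)) x
      (≤-reflexive (trans (cong suc (𝟙-false (x ≺? x) (≺-irrefl x))) (sym (𝟙-true (x ≺? y) x≺y))))

    rank-injective : ∀ {x y} → rank x ≡ rank y → x ≡ y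
    rank-injective {x} {y} eq with x Finₚ.≟ y
    ... | yes x≡y = x≡y
    ... | no  x≢y with ≺-total x≢y
    ...   | inj₁ x≺y = contradiction eq (<⇒≢ (rank-mono x≺y))
    ...   | inj₂ y≺x = contradiction (sym eq) (<⇒≢ (rank-mono y≺x))

    -- Ranks are distinct and below `n`, so they permute the numbers from `0` to `n - 1`. Sums over
    -- an angular order can thus be evaluated without sorting the points.
    ∑-rank : ∀ (f : ℕ → ℕ) → ∑[ x < n ] f (rank x) ≡ ∑[ i < n ] f (toℕ i)
    ∑-rank f = trans (sum-cong-≗ λ x → cong f (sym (Finₚ.toℕ-fromℕ< (rank<n x))))
      (sym (sum-permute (f ∘ toℕ) (proj₁ π)))
      where
      π = injective⇒permutation (λ x → fromℕ< (rank<n x)) λ {x} {y} eq → rank-injective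
        (trans (sym (Finₚ.toℕ-fromℕ< (rank<n x)))
          (trans (cong toℕ eq) (Finₚ.toℕ-fromℕ< (rank<n y))))

  -- Closed forms of elementary sums

  ∑-≡ : ∀ x n → ∑[ i < n ] 𝟙 (x ≟ toℕ i) ≡ 𝟙 (x <? n)
  ∑-≡ x       zero    = sym (𝟙-false (x <? 0) λ ())
  ∑-≡ zero    (suc n) = cong suc (sum-0 {n} λ i → 𝟙-false (0 ≟ suc (toℕ i)) λ ())
  ∑-≡ (suc x) (suc n) = begin
    ∑[ i < n ] 𝟙 (suc x ≟ suc (toℕ i))
      ≡⟨ (sum-cong-≗ {n} λ i → 𝟙-cong (suc x ≟ suc (toℕ i)) (x ≟ toℕ i) suc-injective (cong suc)) ⟩
    ∑[ i < n ] 𝟙 (x ≟ toℕ i)  ≡⟨ ∑-≡ x n ⟩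
    𝟙 (x <? n)                ≡⟨ 𝟙-cong (x <? n) (suc x <? suc n) s≤s s≤s⁻¹ ⟩
    𝟙 (suc x <? suc n)        ∎
    where open ≡-Reasoning

  ∑-< : ∀ {r} n → r ≤ n → ∑[ i < n ] 𝟙 (toℕ i <? r) ≡ r
  ∑-< {zero}  n       r≤n = sum-0 {n} λ i → 𝟙-false (toℕ i <? 0) λ ()
  ∑-< {suc r} (suc n) (s≤s r≤n) = cong suc (trans
    (sum-cong-≗ {n} λ i → 𝟙-cong (suc (toℕ i) <? suc r) (toℕ i <? r) s≤s⁻¹ s≤s) (∑-< n r≤n))

  ∑-> : ∀ r n → ∑[ i < n ] 𝟙 (r <? toℕ i) ≡ n ∸ suc r
  ∑-> r       zero    = refl
  ∑-> zero    (suc n) = sum-1 {n} λ i → 𝟙-true (0 <? suc (toℕ i)) (s≤s z≤n)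
  ∑-> (suc r) (suc n) = trans
    (sum-cong-≗ {n} λ i → 𝟙-cong (suc r <? suc (toℕ i)) (r <? toℕ i) s≤s⁻¹ s≤s) (∑-> r n)

  -- Truncation gives the correct value `0` when `k < o`, and the bound makes the range long enough
  -- to contain every solution `i`.
  ∑-+≤ : ∀ o k n → suc k ∸ o ≤ n → ∑[ i < n ] 𝟙 (o + toℕ i ≤? k) ≡ suc k ∸ o
  ∑-+≤ o k n bound = trans
    (sum-cong-≗ {n} λ i → 𝟙-cong (o + toℕ i ≤? k) (toℕ i <? suc k ∸ o)
      (λ le → m+n≤o⇒m≤o∸n (suc (toℕ i)) (s≤s (subst (_≤ k) (+-comm o (toℕ i)) le)))
      (λ lt → subst (_≤ k) (+-comm (toℕ i) o) (s≤s⁻¹ (m<n∸o⇒m+o<n {toℕ i} lt))))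
    (∑-< n bound)
    where
    m<n∸o⇒m+o<n : ∀ {i} → i < suc k ∸ o → i + o < suc k
    m<n∸o⇒m+o<n {i} lt = m≤o∸n⇒m+n≤o (suc i) (<⇒≤ (m∸n≢0⇒n<m (m<n⇒n≢0 lt))) lt

  -- Pascal's rule, one term at a time. Terms beyond `x` vanish by truncation, so that the range may
  -- have any length `n ≥ x`.
  ∑-∸ : ∀ x n → x ≤ n → ∑[ i < n ] (x ∸ toℕ i) ≡ suc x C 2
  ∑-∸ zero    n       x≤n = sum-0 {n} λ i → 0∸n≡0 (toℕ i)
  ∑-∸ (suc x) (suc n) (s≤s x≤n) = begin
    suc x + ∑[ i < n ] (x ∸ toℕ i)  ≡⟨ cong₂ _+_ (sym (nC1≡n (suc x))) (∑-∸ x n x≤n) ⟩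
    suc x C 1 + suc x C 2           ≡⟨ nCk+nC[k+1]≡[n+1]C[k+1] (suc x) 1 ⟩
    suc (suc x) C 2                 ∎
    where open ≡-Reasoning

  -- This is the preceding triangular sum with `x = n`, read backwards.
  ∑-suc : ∀ n → ∑[ i < n ] suc (toℕ i) ≡ suc n C 2
  ∑-suc n = begin
    ∑[ i < n ] suc (toℕ i)
      ≡⟨ sum-cong-≗ {n} (λ i → sym (trans (cong (n ∸_) (Finₚ.opposite-prop i))
           (m∸[m∸n]≡n (Finₚ.toℕ<n i)))) ⟩
    ∑[ i < n ] (n ∸ toℕ (opposite i))  ≡⟨ ∑-opposite {n} (λ i → n ∸ toℕ i) ⟩
    ∑[ i < n ] (n ∸ toℕ i)             ≡⟨ ∑-∸ n n ≤-refl ⟩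
    suc n C 2                          ∎
    where open ≡-Reasoning

open Counting

-- Counting (≤k)-edges

module EdgeCount {c ℓ₁ ℓ₂} (F : OrderedField c ℓ₁ ℓ₂) (m′ : ℕ)
                 (S : Plane.ThreeChains F (suc m′)) where

  open Plane F
  open Orientation F
  open ThreeChains S renaming (C to Cs)
  open Configuration F m′ S
  open StrictTotalOrder (OrderedField.strictTotalOrder F) using (module Eq)

  private
    m = suc m′

    ≈ₚ-refl : ∀ {p} → p ≈ₚ p
    ≈ₚ-refl = Eq.refl , Eq.refl

  rights : ∀ {n} → Point → Point → (Fin n → Point) → ℕ
  rights p q f = ∑[ t < _ ] 𝟙 (rightOf? p q (f t))

  left⇒¬right : ∀ {p q x} → LeftOf p q x → ¬ RightOf p q x
  left⇒¬right pqx = left-asym pqx ∘ right⇒left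

  ¬right-first : ∀ {p q} → ¬ RightOf p q p
  ¬right-first pqp = left⇒≉ (right⇒left pqp) ≈ₚ-refl

  ¬right-second : ∀ {p q} → ¬ RightOf p q q
  ¬right-second pqq = left⇒≉ (rotateˡ (right⇒left pqq)) ≈ₚ-refl

  rights-all : ∀ {n p q} {f : Fin n → Point} → (∀ t → LeftOf q p (f t)) → rights p q f ≡ n
  rights-all {f = f} right = sum-1 λ t → 𝟙-true (rightOf? _ _ (f t)) (left⇒right (right t))

  rights-none : ∀ {n p q} {f : Fin n → Point} → (∀ t → LeftOf p q (f t)) → rights p q f ≡ 0
  rights-none {f = f} left = sum-0 λ t → 𝟙-false (rightOf? _ _ (f t)) (left⇒¬right (left t))

  rights-before : ∀ {n p q} {f : Fin n → Point} r → ¬ RightOf p q (f r) →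
                  (∀ t → t Fin.< r → LeftOf q p (f t)) → (∀ t → r Fin.< t → LeftOf p q (f t)) →
                  rights p q f ≡ toℕ r
  rights-before {n} {p} {q} {f} r ¬right right left =
    trans (sum-cong-≗ {n} λ t → 𝟙-cong (rightOf? p q (f t)) (toℕ t <? toℕ r)
             (before t) (left⇒right ∘ right t))
      (∑-< n (<⇒≤ (Finₚ.toℕ<n r)))
    where
    before : ∀ t → RightOf p q (f t) → toℕ t < toℕ r
    before t pqt with Finₚ.<-cmp t r
    ... | tri< t<r _ _  = t<r
    ... | tri≈ _ refl _ = contradiction pqt ¬right
    ... | tri> _ _ r<t  = contradiction pqt (left⇒¬right (left t r<t))

  rights-after : ∀ {n p q} {f : Fin n → Point} r → ¬ RightOf p q (f r) →
                 (∀ t → t Fin.< r → LeftOf p q (f t)) → (∀ t → r Fin.< t → LeftOf q p (f t)) →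
                 rights p q f ≡ toℕ (opposite r)
  rights-after {n} {p} {q} {f} r ¬right left right =
    trans (sum-cong-≗ {n} λ t → 𝟙-cong (rightOf? p q (f t)) (toℕ r <? toℕ t)
             (after t) (left⇒right ∘ right t))
      (trans (∑-> (toℕ r) n) (sym (Finₚ.opposite-prop r)))
    where
    after : ∀ t → RightOf p q (f t) → toℕ r < toℕ t
    after t pqt with Finₚ.<-cmp t r
    ... | tri< t<r _ _  = contradiction pqt (left⇒¬right (left t t<r))
    ... | tri≈ _ refl _ = contradiction pqt ¬right
    ... | tri> _ _ r<t  = r<t

  listSum-points : ∀ f → listSum f points ≡ ∑[ l < 3 ] (sum (f ∘ AB l) + sum (f ∘ Cs l))
  listSum-points f = trans (listSum-concat f (λ l → tabulate (AB l) ++ tabulate (Cs l)))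
    (sum-cong-≗ {3} λ l → trans (listSum-++ f (tabulate (AB l)) (tabulate (Cs l)))
      (cong₂ _+_ (listSum-tabulate f (AB l)) (listSum-tabulate f (Cs l))))

  ∑-cyclic : ∀ {i j k} → Cyclic i j k → ∀ (f : Fin 3 → ℕ) → sum f ≡ f i + (f j + f k)
  ∑-cyclic cyc₀ f = cong (λ x → f _ + (f _ + x)) (+-identityʳ _)
  ∑-cyclic cyc₁ f = solve 3 (λ x y z → x :+ (y :+ (z :+ con 0)) := y :+ (z :+ x)) refl
    (f zero) (f (suc zero)) (f (suc (suc zero)))
    where open +-*-Solver
  ∑-cyclic cyc₂ f = solve 3 (λ x y z → x :+ (y :+ (z :+ con 0)) := z :+ (x :+ y)) refl
    (f zero) (f (suc zero)) (f (suc (suc zero)))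
    where open +-*-Solver

  rightCount-chains : ∀ {i j k} → Cyclic i j k → ∀ p q → rightCount points p q ≡
    (rights p q (AB i) + rights p q (Cs i))
      + ((rights p q (AB j) + rights p q (Cs j)) + (rights p q (AB k) + rights p q (Cs k)))
  rightCount-chains σ p q = trans (length-filter (rightOf? p q) points)
    (trans (listSum-points (λ x → 𝟙 (rightOf? p q x)))
      (∑-cyclic σ (λ l → rights p q (AB l) + rights p q (Cs l))))

  rightCount-≡ : ∀ {i j k} → Cyclic i j k → ∀ {p q a a′ b b′ d d′} →
    rights p q (AB i) ≡ a → rights p q (Cs i) ≡ a′ →
    rights p q (AB j) ≡ b → rights p q (Cs j) ≡ b′ →
    rights p q (AB k) ≡ d → rights p q (Cs k) ≡ d′ →
    rightCount points p q ≡ (a + a′) + ((b + b′) + (d + d′))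
  rightCount-≡ σ {p} {q} refl refl refl refl refl refl = rightCount-chains σ p q

  -- When k is the chain before i, these are the points to the left of the lines
  -- within A ∪ B of chain i.
  others′ : Fin 3 → Fin 3 → Fin m ⊎ (Fin (3 * m) ⊎ Fin m) → Point
  others′ i k = [ Cs i , chain k ]′

  -- The far points have to form a single family indexed by a `Fin` for the rank argument to apply
  -- to them.
  split₃ : Fin (m + (3 * m + m)) → Fin m ⊎ (Fin (3 * m) ⊎ Fin m)
  split₃ x = [ inj₁ , inj₂ ∘ splitAt (3 * m) ]′ (splitAt m x)

  split₃-injective : ∀ {x y} → split₃ x ≡ split₃ y → x ≡ y
  split₃-injective {x} {y} eq = trans (sym (unsplit x)) (trans (cong unsplit′ eq) (unsplit y))
    where
    unsplit′ : Fin m ⊎ (Fin (3 * m) ⊎ Fin m) → Fin (m + (3 * m + m))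
    unsplit′ = Fin.join m (3 * m + m) ∘ [ inj₁ , inj₂ ∘ Fin.join (3 * m) m ]′
    unsplit : ∀ x → unsplit′ (split₃ x) ≡ x
    unsplit x with splitAt m x in eq′
    ... | inj₁ t = trans (cong (Fin.join m (3 * m + m)) (sym eq′))
      (Finₚ.join-splitAt m (3 * m + m) x)
    ... | inj₂ y = trans (cong (m ↑ʳ_) (Finₚ.join-splitAt (3 * m) m y))
      (trans (cong (Fin.join m (3 * m + m)) (sym eq′)) (Finₚ.join-splitAt m (3 * m + m) x))

  others : Fin 3 → Fin 3 → Fin (m + (3 * m + m)) → Point
  others i k = others′ i k ∘ split₃

  ∑-others : ∀ i k (f : Point → ℕ) →
             sum (f ∘ others i k) ≡ sum (f ∘ Cs i) + (sum (f ∘ AB k) + sum (f ∘ Cs k))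
  ∑-others i k f = trans (sum-split m (f ∘ others i k)) (cong₂ _+_
    (sum-cong-≗ λ t → cong (f ∘ others′ i k ∘ [ inj₁ , inj₂ ∘ splitAt (3 * m) ]′)
      (Finₚ.splitAt-↑ˡ m t (3 * m + m)))
    (trans (sum-split (3 * m) (f ∘ others i k ∘ (m ↑ʳ_))) (cong₂ _+_
      (sum-cong-≗ λ t → cong (f ∘ others′ i k) (trans
        (cong [ inj₁ , inj₂ ∘ splitAt (3 * m) ]′ (Finₚ.splitAt-↑ʳ m (3 * m + m) (t ↑ˡ m)))
        (cong inj₂ (Finₚ.splitAt-↑ˡ (3 * m) t m))))
      (sum-cong-≗ λ t → cong (f ∘ others′ i k) (trans
        (cong [ inj₁ , inj₂ ∘ splitAt (3 * m) ]′ (Finₚ.splitAt-↑ʳ m (3 * m + m) ((3 * m) ↑ʳ t)))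
        (cong inj₂ (Finₚ.splitAt-↑ʳ (3 * m) m t)))))))

  -- The angular order around a point of A ∪ B

  next-before-others : ∀ {i j k} → Cyclic i j k → ∀ r y x →
                       LeftOf (AB i r) (chain j y) (others′ i k x)
  next-before-others σ r (inj₁ y) (inj₁ t)        = AB-AB-C σ r y _ t
  next-before-others σ r (inj₂ y) (inj₁ t)        = AB-C-own σ r y t
  next-before-others σ r (inj₁ y) (inj₂ (inj₁ t)) = AB-AB-AB σ r y t
  next-before-others σ r (inj₂ y) (inj₂ (inj₁ t)) = rotateˡ (AB-AB-C (shift (shift σ)) t r _ y)
  next-before-others σ r (inj₁ y) (inj₂ (inj₂ t)) = AB-AB-C σ r y _ t
  next-before-others σ r (inj₂ y) (inj₂ (inj₂ t)) = AB-C-remaining σ r y t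

  others-left : ∀ {i j k} → Cyclic i j k → ∀ {r s} → r Fin.< s → ∀ x →
                LeftOf (AB i r) (AB i s) (others′ i k x)
  others-left {i} σ r<s (inj₁ t) = AB-ownC i r<s t
  others-left σ r<s (inj₂ x) = left-remaining σ r<s x

  first≢third : ∀ {i j k} → Cyclic i j k → i ≢ k
  first≢third cyc₀ ()
  first≢third cyc₁ ()
  first≢third cyc₂ ()

  -- Two points of type `C` are ordered because `AB i r` is not on their line. Two points of `A ∪ B`
  -- in chain `k` span a line that leaves chain `i`, the one following `k`, on its right. A point of
  -- each kind is ordered by `AB-AB-C`.
  others-total : ∀ {i j k} → Cyclic i j k → ∀ r {x y} → x ≢ y →
                 LeftOf (AB i r) (others′ i k x) (others′ i k y) ⊎
                 LeftOf (AB i r) (others′ i k y) (others′ i k x)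
  others-total {i} {k = k} σ r = total
    where
    σ′ = shift (shift σ)
    total : ∀ {x y} → x ≢ y → LeftOf (AB i r) (others′ i k x) (others′ i k y) ⊎
                              LeftOf (AB i r) (others′ i k y) (others′ i k x)
    total {inj₁ t}        {inj₁ u}        x≢y = AB∉C-C i r i t i u λ { refl → x≢y refl }
    total {inj₁ t}        {inj₂ (inj₁ u)} x≢y = inj₁ (rotateˡ (AB-AB-C σ′ u r i t))
    total {inj₁ t}        {inj₂ (inj₂ u)} x≢y = AB∉C-C i r i t k u (first≢third σ ∘ cong proj₁)
    total {inj₂ (inj₁ t)} {inj₁ u}        x≢y = inj₂ (rotateˡ (AB-AB-C σ′ t r i u))
    total {inj₂ (inj₁ t)} {inj₂ (inj₁ u)} x≢y with Finₚ.<-cmp t u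
    ... | tri< t<u _ _  = inj₂ (rotateʳ (right-next σ′ t<u (inj₁ r)))
    ... | tri≈ _ refl _ = contradiction refl x≢y
    ... | tri> _ _ u<t  = inj₁ (rotateʳ (right-next σ′ u<t (inj₁ r)))
    total {inj₂ (inj₁ t)} {inj₂ (inj₂ u)} x≢y = inj₂ (rotateˡ (AB-AB-C σ′ t r k u))
    total {inj₂ (inj₂ t)} {inj₁ u}        x≢y =
      AB∉C-C i r k t i u (first≢third σ ∘ sym ∘ cong proj₁)
    total {inj₂ (inj₂ t)} {inj₂ (inj₁ u)} x≢y = inj₁ (rotateˡ (AB-AB-C σ′ u r k t))
    total {inj₂ (inj₂ t)} {inj₂ (inj₂ u)} x≢y = AB∉C-C i r k t k u λ { refl → x≢y refl }

  -- Within a half-plane bounded by a line through `p`, the points are linearly ordered by angle.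
  -- The points to the right of the line from `p` to `f x` are those before `f x`, and those to the
  -- right of the reversed line come after it; either count takes each value below `n` once.
  module Pencil {n} {p u} (f : Fin n → Point) (half-plane : ∀ x → LeftOf p u (f x))
                (total : ∀ {x y} → x ≢ y → LeftOf p (f x) (f y) ⊎ LeftOf p (f y) (f x)) where

    ∑-rights : ∀ (g : ℕ → ℕ) → ∑[ x < n ] g (rights p (f x) f) ≡ ∑[ t < n ] g (toℕ t)
    ∑-rights = Rank.∑-rank {_≺_ = λ y x → RightOf p (f x) (f y)} (λ y x → rightOf? p (f x) (f y))
      (λ x → ¬right-second)
      (λ {x} {y} {z} xy yz → to
        (left-transˡ (half-plane x) (half-plane y) (half-plane z) (from xy) (from yz)))
      (λ x≢y → [ inj₁ ∘ to , inj₂ ∘ to ]′ (total x≢y))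
      where
      from : ∀ {x y} → RightOf p (f y) (f x) → LeftOf p (f x) (f y)
      from xy = rotateˡ (right⇒left xy)
      to : ∀ {x y} → LeftOf p (f x) (f y) → RightOf p (f y) (f x)
      to xy = left⇒right (rotateʳ xy)

    ∑-rights′ : ∀ (g : ℕ → ℕ) → ∑[ x < n ] g (rights (f x) p f) ≡ ∑[ t < n ] g (toℕ t)
    ∑-rights′ = Rank.∑-rank {_≺_ = λ y x → RightOf (f x) p (f y)} (λ y x → rightOf? (f x) p (f y))
      (λ x → ¬right-first)
      (λ {x} {y} {z} xy yz → left⇒right (left-transˡ
        (half-plane z) (half-plane y) (half-plane x) (right⇒left yz) (right⇒left xy)))
      (λ x≢y → [ inj₂ ∘ left⇒right , inj₁ ∘ left⇒right ]′ (total x≢y))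

  -- Points to the right of each kind of line

  rightCount-AB : ∀ {i j k} → Cyclic i j k → ∀ {r s} → r Fin.< s →
                  rightCount points (AB i r) (AB i s) ≡ (4 * m + toℕ r) + toℕ (opposite s)
  rightCount-AB {i} σ {r} {s} r<s = trans
    (rightCount-≡ σ own (rights-none (AB-ownC i r<s))
      (rights-all (right-next σ r<s ∘ inj₁)) (rights-all (right-next σ r<s ∘ inj₂))
      (rights-none (left-remaining σ r<s ∘ inj₁)) (rights-none (left-remaining σ r<s ∘ inj₂)))
    (solve 3 (λ m r s → (r :+ s :+ con 0) :+ ((con 3 :* m :+ m) :+ (con 0 :+ con 0))
                        := (con 4 :* m :+ r) :+ s) refl m (toℕ r) (toℕ (opposite s)))
    where
    open +-*-Solver
    -- The chain bends to the right, so its part between `r` and `s` bulges to the left of the line,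
    -- while the parts before `r` and after `s` fall to the right.
    beyond : ∀ t → 𝟙 (rightOf? (AB i r) (AB i s) (AB i t)) ≡ 𝟙 (toℕ t <? toℕ r) + 𝟙 (toℕ s <? toℕ t)
    beyond t with Finₚ.<-cmp t r | Finₚ.<-cmp t s
    ... | tri< t<r _ _ | _ = trans
      (𝟙-true (rightOf? _ _ (AB i t))
        (left⇒right (rotateʳ (right⇒left (AB-convexRight i t<r r<s)))))
      (sym (cong₂ _+_ (𝟙-true (_ <? _) t<r) (𝟙-false (_ <? _) (<⇒≯ (<-trans t<r r<s)))))
    ... | _ | tri> _ _ s<t = trans
      (𝟙-true (rightOf? _ _ (AB i t)) (AB-convexRight i r<s s<t))
      (sym (cong₂ _+_ (𝟙-false (_ <? _) (<⇒≯ (<-trans r<s s<t))) (𝟙-true (_ <? _) s<t)))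
    ... | tri> t≮r _ r<t | tri< t<s _ s≮t = trans
      (𝟙-false (rightOf? _ _ (AB i t))
        (left⇒¬right (rotateˡ (right⇒left (AB-convexRight i r<t t<s)))))
      (sym (cong₂ _+_ (𝟙-false (_ <? _) t≮r) (𝟙-false (_ <? _) s≮t)))
    ... | tri≈ t≮r refl _ | tri< _ _ s≮t = trans
      (𝟙-false (rightOf? _ _ (AB i t)) ¬right-first)
      (sym (cong₂ _+_ (𝟙-false (_ <? _) t≮r) (𝟙-false (_ <? _) s≮t)))
    ... | tri> t≮r _ _ | tri≈ _ refl s≮t = trans
      (𝟙-false (rightOf? _ _ (AB i t)) ¬right-second)
      (sym (cong₂ _+_ (𝟙-false (_ <? _) t≮r) (𝟙-false (_ <? _) s≮t)))
    ... | tri≈ _ refl _ | tri≈ _ refl _ = contradiction r<s (<-irrefl refl)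
    own : rights (AB i r) (AB i s) (AB i) ≡ toℕ r + toℕ (opposite s)
    own = trans (sum-cong-≗ {3 * m} beyond) (trans
      (∑-distrib-+ {3 * m} (λ t → 𝟙 (toℕ t <? toℕ r)) (λ t → 𝟙 (toℕ s <? toℕ t)))
      (cong₂ _+_ (∑-< (3 * m) (<⇒≤ (Finₚ.toℕ<n r)))
        (trans (∑-> (toℕ s) (3 * m)) (sym (Finₚ.opposite-prop s)))))

  -- For `k < 5m`, a directed line with `5m` points on its right contributes nothing, so that this
  -- crude bound suffices to discard it.
  5m≤rightCount : ∀ {i j k} → Cyclic i j k → ∀ {p q a a′ b b′ d d′} →
    a ≤ rights p q (AB i) → a′ ≤ rights p q (Cs i) →
    b ≤ rights p q (AB j) → b′ ≤ rights p q (Cs j) →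
    d ≤ rights p q (AB k) → d′ ≤ rights p q (Cs k) →
    5 * m ≡ (a + a′) + ((b + b′) + (d + d′)) → 5 * m ≤ rightCount points p q
  5m≤rightCount σ {p} {q} a a′ b b′ d d′ eq = ≤-trans (≤-reflexive eq)
    (≤-trans (+-mono-≤ (+-mono-≤ a a′) (+-mono-≤ (+-mono-≤ b b′) (+-mono-≤ d d′)))
      (≤-reflexive (sym (rightCount-chains σ p q))))

  rights-all-≤ : ∀ {n p q} {f : Fin n → Point} → (∀ t → LeftOf q p (f t)) → n ≤ rights p q f
  rights-all-≤ right = ≤-reflexive (sym (rights-all right))

  rightCount-AB-outward : ∀ {i j k} → Cyclic i j k → ∀ {r s} → r Fin.< s →
                          5 * m ≤ rightCount points (AB i s) (AB i r)
  rightCount-AB-outward {i} σ r<s = 5m≤rightCount σ z≤n (rights-all-≤ (AB-ownC i r<s)) z≤n z≤n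
    (rights-all-≤ (left-remaining σ r<s ∘ inj₁)) (rights-all-≤ (left-remaining σ r<s ∘ inj₂))
    (solve 1 (λ m → con 5 :* m := (con 0 :+ m) :+ ((con 0 :+ con 0) :+ (con 3 :* m :+ m))) refl m)
    where open +-*-Solver

  rightCount-AB-others : ∀ {i j k} → Cyclic i j k → ∀ r x →
    rightCount points (AB i r) (others i k x)
      ≡ (4 * m + toℕ (opposite r)) + rights (AB i r) (others i k x) (others i k)
  rightCount-AB-others {i} {j} {k} σ r x = trans
    (rightCount-≡ σ
      (rights-after r ¬right-first
        (λ t t<r → rotateˡ (others-left σ t<r y))
        (λ t r<t → rotateʳ (others-left σ r<t y)))
      refl
      (rights-all λ t → rotateʳ (next-before-others σ r (inj₁ t) y))
      (rights-all λ t → rotateʳ (next-before-others σ r (inj₂ t) y))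
      refl refl)
    (trans (solve 4 (λ m r c d →
          (r :+ c) :+ ((con 3 :* m :+ m) :+ d) := (con 4 :* m :+ r) :+ (c :+ d)) refl
        m (toℕ (opposite r)) (rights p q (Cs i)) (rights p q (AB k) + rights p q (Cs k)))
      (cong (4 * m + toℕ (opposite r) +_) (sym (∑-others i k (λ z → 𝟙 (rightOf? p q z))))))
    where
    open +-*-Solver
    y = split₃ x
    p = AB i r
    q = others i k x

  rightCount-others-AB : ∀ {i j k} → Cyclic i j k → ∀ r x →
    rightCount points (others i k x) (AB i r)
      ≡ toℕ r + rights (others i k x) (AB i r) (others i k)
  rightCount-others-AB {i} {j} {k} σ r x = trans
    (rightCount-≡ σ
      (rights-before r ¬right-second
        (λ t t<r → rotateˡ (others-left σ t<r y))
        (λ t r<t → rotateʳ (others-left σ r<t y)))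
      refl
      (rights-none λ t → rotateʳ (next-before-others σ r (inj₁ t) y))
      (rights-none λ t → rotateʳ (next-before-others σ r (inj₂ t) y))
      refl refl)
    (trans (+-assoc (toℕ r) (rights q p (Cs i)) (rights q p (AB k) + rights q p (Cs k)))
      (cong (toℕ r +_) (sym (∑-others i k (λ z → 𝟙 (rightOf? q p z))))))
    where
    y = split₃ x
    p = AB i r
    q = others i k x

  rightCount-AB-nextC : ∀ {i j k} → Cyclic i j k → ∀ r t →
    rightCount points (AB i r) (Cs j t) ≡ (3 * m + toℕ r) + rights (AB i r) (Cs j t) (Cs j)
  rightCount-AB-nextC {i} {j} {k} σ r t = trans
    (rightCount-≡ σ
      (rights-before r ¬right-first
        (λ u u<r → rotateʳ (right-next σ u<r (inj₂ t)))
        (λ u r<u → rotateˡ (right-next σ r<u (inj₂ t))))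
      (rights-none λ u → next-before-others σ r (inj₂ t) (inj₁ u))
      (rights-all λ u → rotateʳ (AB-AB-C σ r u j t))
      refl
      (rights-none λ u → next-before-others σ r (inj₂ t) (inj₂ (inj₁ u)))
      (rights-none λ u → next-before-others σ r (inj₂ t) (inj₂ (inj₂ u))))
    (solve 3 (λ m r x →
        (r :+ con 0) :+ ((con 3 :* m :+ x) :+ (con 0 :+ con 0)) := (con 3 :* m :+ r) :+ x) refl
      m (toℕ r) (rights (AB i r) (Cs j t) (Cs j)))
    where open +-*-Solver

  rightCount-nextC-AB : ∀ {i j k} → Cyclic i j k → ∀ r t →
                        5 * m ≤ rightCount points (Cs j t) (AB i r)
  rightCount-nextC-AB σ r t = 5m≤rightCount σ z≤n
    (rights-all-≤ λ u → next-before-others σ r (inj₂ t) (inj₁ u)) z≤n z≤n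
    (rights-all-≤ λ u → next-before-others σ r (inj₂ t) (inj₂ (inj₁ u)))
    (rights-all-≤ λ u → next-before-others σ r (inj₂ t) (inj₂ (inj₂ u)))
    (solve 1 (λ m → con 5 :* m := (con 0 :+ m) :+ ((con 0 :+ con 0) :+ (con 3 :* m :+ m))) refl m)
    where open +-*-Solver

  -- To the right of `nd` are `B` of chain `s` and the whole next chain, `m + 4m` points; to the
  -- left, `A` of chain `s` and `A ∪ B` of the remaining chain, `2m + 3m` points.
  rightCount-Separation : ∀ {n d} → Separation n d →
                          5 * m ≤ rightCount points n d × 5 * m ≤ rightCount points d n
  rightCount-Separation {n} {d} sep =
      5m≤rightCount cyclic inner z≤n
        (rights-all-≤ (next-right ∘ inj₁)) (rights-all-≤ (next-right ∘ inj₂)) z≤n z≤n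
        (solve 1 (λ m → con 5 :* m :=
          (m :+ con 0) :+ ((con 3 :* m :+ m) :+ (con 0 :+ con 0))) refl m)
    , 5m≤rightCount cyclic outer z≤n z≤n z≤n (rights-all-≤ remaining-left) z≤n
        (solve 1 (λ m → con 5 :* m :=
          (con 2 :* m :+ con 0) :+ ((con 0 :+ con 0) :+ (con 3 :* m :+ con 0))) refl m)
    where
    open +-*-Solver
    open Separation sep
    inner : m ≤ rights n d (AB s)
    -- As `m` is a successor, `pred (2 * m) < toℕ t` computes to `2 * m ≤ toℕ t`.
    inner = ≤-trans (≤-reflexive (sym (trans (∑-> (pred (2 * m)) (3 * m)) (m+n∸n≡m m (2 * m)))))
      (sum-mono-≤ {3 * m} λ t → 𝟙-mono (pred (2 * m) <? toℕ t) (rightOf? n d (AB s t))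
        (left⇒right ∘ inner-right t))
    outer : 2 * m ≤ rights d n (AB s)
    outer = ≤-trans (≤-reflexive (sym (∑-< (3 * m) (m≤n+m (2 * m) m))))
      (sum-mono-≤ {3 * m} λ t → 𝟙-mono (toℕ t <? 2 * m) (rightOf? d n (AB s t))
        (left⇒right ∘ outer-left t))

  ∑-prev : ∀ (f : Fin 3 → Fin 3 → ℕ) → ∑[ l < 3 ] f l (next l) ≡ ∑[ l < 3 ] f (next (next l)) l
  ∑-prev f = solve 3 (λ x y z → x :+ (y :+ (z :+ con 0)) := z :+ (x :+ (y :+ con 0))) refl
    (f zero (suc zero)) (f (suc zero) (suc (suc zero))) (f (suc (suc zero)) zero)
    where open +-*-Solver

  ∑∑-cyclic : ∀ (f : Fin 3 → Fin 3 → ℕ) → ∑[ l < 3 ] ∑[ l′ < 3 ] f l l′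
    ≡ ∑[ l < 3 ] (f l l + (f l (next l) + f l (next (next l))))
  ∑∑-cyclic f = sum-cong-≗ {3} λ l → ∑-cyclic (cyclic-next l) (f l)

  -- Reduction to sums over pairs of points

  module Pairs (k : ℕ) (k<5m : suc k ≤ 5 * m) where

    -- The condition of being a `j`-edge for some `j ≤ k`. Distinctness matters: a pair of equal
    -- points has no point on its right and would otherwise be counted.
    near? : ∀ p q → Dec (¬ p ≈ₚ q × rightCount points p q ≤ k)
    near? p q = ¬? (p ≟ₚ q) ×-dec (rightCount points p q ≤? k)

    W : Point → Point → ℕ
    W p q = 𝟙 (near? p q)

    W-≡ : ∀ {p q v} → ¬ p ≈ₚ q → rightCount points p q ≡ v → W p q ≡ 𝟙 (v ≤? k)
    W-≡ {p} {q} p≉q refl = 𝟙-cong (near? p q) (_ ≤? k) proj₂ (p≉q ,_)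

    W-far : ∀ {p q} → 5 * m ≤ rightCount points p q → W p q ≡ 0
    W-far {p} {q} far = 𝟙-false (near? p q) λ (_ , near) → <⇒≱ (≤-trans k<5m far) near

    W-diagonal : ∀ p → W p p ≡ 0
    W-diagonal p = 𝟙-false (near? p p) λ (p≉p , _) → p≉p ≈ₚ-refl

    N : ∀ {a b} → (Fin a → Point) → (Fin b → Point) → ℕ
    N {a} {b} f g = ∑[ x < a ] ∑[ y < b ] W (f x) (g y)

    ∑-isEdge : ∀ p q → listSum (λ j → 𝟙 (isEdge? j points (p , q))) (upTo (suc k)) ≡ W p q
    ∑-isEdge p q = trans (listSum-applyUpTo (λ j → 𝟙 (isEdge? j points (p , q))) id (suc k))
      (count (p ≟ₚ q))
      where
      edge? : ∀ (j : Fin (suc k)) → Dec (IsEdge (toℕ j) points (p , q))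
      edge? j = isEdge? (toℕ j) points (p , q)
      count : Dec (p ≈ₚ q) → ∑[ j < suc k ] 𝟙 (edge? j) ≡ W p q
      count (yes p≈q) = trans (sum-0 {suc k} λ j → 𝟙-false (edge? j) (λ (p≉q , _) → p≉q p≈q))
        (sym (𝟙-false (near? p q) (λ (p≉q , _) → p≉q p≈q)))
      count (no p≉q) = begin
        ∑[ j < suc k ] 𝟙 (edge? j)
          ≡⟨ sum-cong-≗ {suc k} (λ j → 𝟙-cong (edge? j) (_ ≟ toℕ j) proj₂ (p≉q ,_)) ⟩
        ∑[ j < suc k ] 𝟙 (rightCount points p q ≟ toℕ j)
          ≡⟨ ∑-≡ (rightCount points p q) (suc k) ⟩
        𝟙 (rightCount points p q <? suc k)
          ≡⟨ 𝟙-cong (_ <? suc k) (near? p q) (λ lt → p≉q , s≤s⁻¹ lt) (s≤s ∘ proj₂) ⟩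
        W p q ∎
        where open ≡-Reasoning

    -- The sum over `j` is exchanged with the sum over pairs, each of which is a `j`-edge for at
    -- most one `j`.
    E-pairs : E k points ≡ listSum (λ p → listSum (W p) points) points
    E-pairs = begin
      listSum (λ j → e j points) ranks
        ≡⟨ listSum-cong (λ j → length-filter (isEdge? j points) pairs) ranks ⟩
      listSum (λ j → listSum (λ pq → 𝟙 (isEdge? j points pq)) pairs) ranks
        ≡⟨ listSum-comm (λ j pq → 𝟙 (isEdge? j points pq)) ranks pairs ⟩
      listSum (λ pq → listSum (λ j → 𝟙 (isEdge? j points pq)) ranks) pairs
        ≡⟨ listSum-cong (λ (p , q) → ∑-isEdge p q) pairs ⟩
      listSum (λ (p , q) → W p q) pairs
        ≡⟨ listSum-cartesianProduct (λ (p , q) → W p q) points points ⟩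
      listSum (λ p → listSum (W p) points) points ∎
      where
      open ≡-Reasoning
      ranks = upTo (suc k)
      pairs = cartesianProduct points points

    ∑-W : ∀ {a} (f : Fin a → Point) →
          ∑[ x < a ] listSum (W (f x)) points ≡ ∑[ l < 3 ] (N f (AB l) + N f (Cs l))
    ∑-W {a} f = begin
      ∑[ x < a ] listSum (W (f x)) points
        ≡⟨ sum-cong-≗ {a} (λ x → listSum-points (W (f x))) ⟩
      ∑[ x < a ] ∑[ l < 3 ] (toAB l x + toC l x)
        ≡⟨ ∑-comm {a} {3} (λ x l → toAB l x + toC l x) ⟩
      ∑[ l < 3 ] ∑[ x < a ] (toAB l x + toC l x)
        ≡⟨ sum-cong-≗ {3} (λ l → ∑-distrib-+ {a} (toAB l) (toC l)) ⟩
      ∑[ l < 3 ] (N f (AB l) + N f (Cs l)) ∎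
      where
      open ≡-Reasoning
      toAB toC : Fin 3 → Fin a → ℕ
      toAB l x = sum (W (f x) ∘ AB l)
      toC l x = sum (W (f x) ∘ Cs l)

    ∑∑ : (Fin 3 → Fin 3 → ℕ) → ℕ
    ∑∑ f = ∑[ l < 3 ] ∑[ l′ < 3 ] f l l′

    ∑∑-+ : ∀ f g → ∑∑ (λ l l′ → f l l′ + g l l′) ≡ ∑∑ f + ∑∑ g
    ∑∑-+ f g = trans (sum-cong-≗ {3} λ l → ∑-distrib-+ {3} (f l) (g l))
      (∑-distrib-+ {3} (λ l → sum (f l)) (λ l → sum (g l)))

    aa ac ca cc : Fin 3 → Fin 3 → ℕ
    aa l l′ = N (AB l) (AB l′)
    ac l l′ = N (AB l) (Cs l′)
    ca l l′ = N (Cs l) (AB l′)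
    cc l l′ = N (Cs l) (Cs l′)

    E-blocks : E k points ≡ (∑∑ aa + ∑∑ ac) + (∑∑ ca + ∑∑ cc)
    E-blocks = begin
      E k points
        ≡⟨ E-pairs ⟩
      listSum (λ p → listSum (W p) points) points
        ≡⟨ listSum-points (λ p → listSum (W p) points) ⟩
      ∑[ l < 3 ] (fromAB l + fromC l)
        ≡⟨ ∑-distrib-+ {3} fromAB fromC ⟩
      ∑[ l < 3 ] fromAB l + ∑[ l < 3 ] fromC l
        ≡⟨ cong₂ _+_ (sum-cong-≗ {3} (∑-W ∘ AB)) (sum-cong-≗ {3} (∑-W ∘ Cs)) ⟩
      ∑∑ (λ l l′ → aa l l′ + ac l l′) + ∑∑ (λ l l′ → ca l l′ + cc l l′)
        ≡⟨ cong₂ _+_ (∑∑-+ aa ac) (∑∑-+ ca cc) ⟩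
      (∑∑ aa + ∑∑ ac) + (∑∑ ca + ∑∑ cc) ∎
      where
      open ≡-Reasoning
      fromAB fromC : Fin 3 → ℕ
      fromAB l = ∑[ r < 3 * m ] listSum (W (AB l r)) points
      fromC l = ∑[ t < m ] listSum (W (Cs l t)) points

    W-C-C : ∀ l t l′ t′ → (l , t) ≢ (l′ , t′) → W (Cs l t) (Cs l′ t′) ≡ 0
    W-C-C l t l′ t′ distinct′ =
      [ W-far ∘ proj₁ ∘ rightCount-Separation , W-far ∘ proj₂ ∘ rightCount-Separation ]′
        (C-C-separation l t l′ t′ distinct′)

    N-C-C : ∀ l l′ → N (Cs l) (Cs l′) ≡ 0
    N-C-C l l′ = sum-0 {m} λ t → sum-0 {m} λ t′ → W-0 t t′
      where
      W-0 : ∀ t t′ → W (Cs l t) (Cs l′ t′) ≡ 0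
      W-0 t t′ with l Finₚ.≟ l′ | t Finₚ.≟ t′
      ... | yes refl | yes refl = W-diagonal (Cs l t)
      ... | no l≢l′  | _        = W-C-C l t l′ t′ (l≢l′ ∘ cong proj₁)
      ... | yes _    | no t≢t′  = W-C-C l t l′ t′ (t≢t′ ∘ cong proj₂)

    -- Only the pairs with `r < s` can contribute, yet the sum may run over all of them: for `s ≤ r`
    -- the value `4m + r + opposite s` is at least `5m`. Reversing `s` then gives the same summand
    -- as for the lines from `A ∪ B` to the far points.
    N-AB-AB : ∀ i → N (AB i) (AB i) ≡ ∑[ r < 3 * m ] ∑[ s < 3 * m ] 𝟙 ((4 * m + toℕ r) + toℕ s ≤? k)
    N-AB-AB i = sum-cong-≗ {3 * m} λ r → trans (sum-cong-≗ {3 * m} (value r))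
      (∑-opposite {3 * m} (λ s → 𝟙 ((4 * m + toℕ r) + toℕ s ≤? k)))
      where
      σ = cyclic-next i
      outward : ∀ {r s} → toℕ s ≤ toℕ r → 0 ≡ 𝟙 ((4 * m + toℕ r) + toℕ (opposite s) ≤? k)
      outward {r} {s} s≤r = sym (𝟙-false (_ ≤? k) λ le → <⇒≱ (≤-trans k<5m bound) le)
        where
        bound : 5 * m ≤ (4 * m + toℕ r) + toℕ (opposite s)
        bound = begin
          5 * m                                  ≡⟨ +-comm m (4 * m) ⟩
          4 * m + m                              ≤⟨ +-monoʳ-≤ (4 * m) (s≤s⁻¹ m<s+opposite) ⟩
          4 * m + (toℕ s + toℕ (opposite s))     ≡⟨ +-assoc (4 * m) (toℕ s) _ ⟨
          (4 * m + toℕ s) + toℕ (opposite s)     ≤⟨ +-monoˡ-≤ _ (+-monoʳ-≤ (4 * m) s≤r) ⟩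
          (4 * m + toℕ r) + toℕ (opposite s)     ∎
          where
          open ≤-Reasoning
          m<s+opposite : suc m ≤ suc (toℕ s + toℕ (opposite s))
          m<s+opposite = begin
            suc m                              ≡⟨ +-comm 1 m ⟩
            m + 1                              ≤⟨ +-monoʳ-≤ m (s≤s z≤n) ⟩
            3 * m                              ≡⟨ m+[n∸m]≡n (Finₚ.toℕ<n s) ⟨
            suc (toℕ s) + (3 * m ∸ suc (toℕ s)) ≡⟨ cong (suc (toℕ s) +_) (Finₚ.opposite-prop s) ⟨
            suc (toℕ s + toℕ (opposite s))     ∎
      value : ∀ r s → W (AB i r) (AB i s) ≡ 𝟙 ((4 * m + toℕ r) + toℕ (opposite s) ≤? k)
      value r s with Finₚ.<-cmp r s
      ... | tri< r<s _ _  = W-≡ (left⇒≉ (rotateʳ (AB-ownC i r<s zero))) (rightCount-AB σ r<s)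
      ... | tri≈ _ refl _ = trans (W-diagonal (AB i r)) (outward ≤-refl)
      ... | tri> _ _ s<r  = trans (W-far (rightCount-AB-outward σ s<r)) (outward (<⇒≤ s<r))

    AB-others-≉ : ∀ {i j l} → Cyclic i j l → ∀ r x → ¬ others i l x ≈ₚ AB i r
    AB-others-≉ σ r x = left⇒≉ (rotateˡ (next-before-others σ r (inj₂ zero) (split₃ x)))

    tip-left : ∀ {i j l} (σ : Cyclic i j l) r x →
               LeftOf (AB i r) (Axis.tip (axis σ r)) (others′ i l x)
    tip-left σ r (inj₁ t) = Axis.own-left (axis σ r) t
    tip-left σ r (inj₂ x) = Axis.remaining-left (axis σ r) x

    module Others {i j l} (σ : Cyclic i j l) (r : Fin (3 * m)) =
      Pencil {p = AB i r} (others i l) (tip-left σ r ∘ split₃)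
        (λ {x} {y} x≢y → others-total σ r {split₃ x} {split₃ y} (x≢y ∘ split₃-injective))

    module NextC {i j l} (σ : Cyclic i j l) (r : Fin (3 * m)) =
      Pencil {p = AB i r} (Cs j) (λ t → AB-AB-C σ r last j t)
        (λ {t} {u} t≢u → AB∉C-C i r j t j u (t≢u ∘ cong proj₂))

    -- The rank of the far point becomes the summation variable `t`, and reversing `r` removes
    -- `opposite`.
    N-AB-others : ∀ {i j l} → Cyclic i j l → N (AB i) (others i l)
      ≡ ∑[ r < 3 * m ] ∑[ t < m + (3 * m + m) ] 𝟙 ((4 * m + toℕ r) + toℕ t ≤? k)
    N-AB-others {i} {j} {l} σ = trans
      (sum-cong-≗ {3 * m} λ r → trans
        (sum-cong-≗ {m + (3 * m + m)} λ x →
          W-≡ (AB-others-≉ σ r x ∘ ≈ₚ-sym) (rightCount-AB-others σ r x))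
        (Others.∑-rights σ r (λ v → 𝟙 ((4 * m + toℕ (opposite r)) + v ≤? k))))
      (∑-opposite {3 * m} (λ r → ∑[ t < m + (3 * m + m) ] 𝟙 ((4 * m + toℕ r) + toℕ t ≤? k)))
      where
      ≈ₚ-sym : ∀ {p q} → p ≈ₚ q → q ≈ₚ p
      ≈ₚ-sym (x≈ , y≈) = Eq.sym x≈ , Eq.sym y≈

    N-others-AB : ∀ {i j l} → Cyclic i j l → N (others i l) (AB i)
      ≡ ∑[ r < 3 * m ] ∑[ t < m + (3 * m + m) ] 𝟙 (toℕ r + toℕ t ≤? k)
    N-others-AB {i} {j} {l} σ = trans
      (∑-comm {m + (3 * m + m)} {3 * m} (λ x r → W (others i l x) (AB i r)))
      (sum-cong-≗ {3 * m} λ r → trans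
        (sum-cong-≗ {m + (3 * m + m)} λ x → W-≡ (AB-others-≉ σ r x) (rightCount-others-AB σ r x))
        (Others.∑-rights′ σ r (λ v → 𝟙 (toℕ r + v ≤? k))))

    N-AB-nextC : ∀ {i j l} → Cyclic i j l → N (AB i) (Cs j)
      ≡ ∑[ r < 3 * m ] ∑[ t < m ] 𝟙 ((3 * m + toℕ r) + toℕ t ≤? k)
    N-AB-nextC {i} {j} {l} σ = sum-cong-≗ {3 * m} λ r → trans
      (sum-cong-≗ {m} λ t →
        W-≡ (left⇒≉ (rotateʳ (next-before-others σ r (inj₂ t) (inj₁ zero))))
          (rightCount-AB-nextC σ r t))
      (NextC.∑-rights σ r (λ v → 𝟙 ((3 * m + toℕ r) + v ≤? k)))

    N-nextC-AB : ∀ {i j l} → Cyclic i j l → N (Cs j) (AB i) ≡ 0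
    N-nextC-AB σ = sum-0 {m} λ t → sum-0 {3 * m} λ r → W-far (rightCount-nextC-AB σ r t)

    N-others : ∀ {a} (f : Fin a → Point) i l →
               N f (others i l) ≡ N f (Cs i) + (N f (AB l) + N f (Cs l))
    N-others {a} f i l = begin
      N f (others i l)
        ≡⟨ sum-cong-≗ {a} (λ x → ∑-others i l (W (f x))) ⟩
      ∑[ x < a ] (to (Cs i) x + (to (AB l) x + to (Cs l) x))
        ≡⟨ ∑-distrib-+ {a} (to (Cs i)) (λ x → to (AB l) x + to (Cs l) x) ⟩
      N f (Cs i) + ∑[ x < a ] (to (AB l) x + to (Cs l) x)
        ≡⟨ cong (N f (Cs i) +_) (∑-distrib-+ {a} (to (AB l)) (to (Cs l))) ⟩
      N f (Cs i) + (N f (AB l) + N f (Cs l)) ∎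
      where
      open ≡-Reasoning
      to : ∀ {b} → (Fin b → Point) → Fin a → ℕ
      to g x = sum (W (f x) ∘ g)

    others-N : ∀ {b} (g : Fin b → Point) i l →
               N (others i l) g ≡ N (Cs i) g + (N (AB l) g + N (Cs l) g)
    others-N g i l = ∑-others i l (λ p → sum (W p ∘ g))

    -- The share of chain `i` consists of the pairs with an end in its `A ∪ B`, in both directions,
    -- except those with the other end in `A ∪ B` of the next chain, which belong to the share of
    -- that chain.
    perChain : Fin 3 → ℕ
    perChain i = N (AB i) (AB i) + (N (AB i) (others i i″) + (N (others i i″) (AB i)
                   + (N (AB i) (Cs i′) + N (Cs i′) (AB i))))
      where
      i′ = next i
      i″ = next (next i)

    E-perChain : E k points ≡ ∑[ i < 3 ] perChain i
    E-perChain = begin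
      E k points ≡⟨ E-blocks ⟩
      (∑∑ aa + ∑∑ ac) + (∑∑ ca + ∑∑ cc)
        ≡⟨ cong₂ _+_ (cong₂ _+_ aa-sum (∑∑-cyclic ac))
             (cong₂ _+_ ca-sum (sum-0 {3} λ l → sum-0 {3} (N-C-C l))) ⟩
      (∑[ i < 3 ] (aa₁ i + aa₂ i) + ∑[ i < 3 ] ac₁ i) + (∑[ i < 3 ] ca₁ i + 0)
        ≡⟨ cong₂ _+_ (sym (∑-distrib-+ {3} (λ i → aa₁ i + aa₂ i) ac₁)) (+-identityʳ _) ⟩
      ∑[ i < 3 ] ((aa₁ i + aa₂ i) + ac₁ i) + ∑[ i < 3 ] ca₁ i
        ≡⟨ ∑-distrib-+ {3} (λ i → (aa₁ i + aa₂ i) + ac₁ i) ca₁ ⟨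
      ∑[ i < 3 ] (((aa₁ i + aa₂ i) + ac₁ i) + ca₁ i)
        ≡⟨ sum-cong-≗ {3} regroup ⟩
      ∑[ i < 3 ] perChain i ∎
      where
      open ≡-Reasoning
      aa₁ aa₂ ac₁ ca₁ : Fin 3 → ℕ
      aa₁ i = aa (next (next i)) i
      aa₂ i = aa i i + aa i (next (next i))
      ac₁ i = ac i i + (ac i (next i) + ac i (next (next i)))
      ca₁ i = ca i i + (ca (next i) i + ca (next (next i)) i)
      aa-sum : ∑∑ aa ≡ ∑[ i < 3 ] (aa₁ i + aa₂ i)
      aa-sum = begin
        ∑∑ aa
          ≡⟨ ∑∑-cyclic aa ⟩
        ∑[ i < 3 ] (aa i i + (aa i (next i) + aa i (next (next i))))
          ≡⟨ sum-cong-≗ {3} (λ i →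
               x+[y+z]≡y+[x+z] (aa i i) (aa i (next i)) (aa i (next (next i)))) ⟩
        ∑[ i < 3 ] (aa i (next i) + aa₂ i)
          ≡⟨ ∑-distrib-+ {3} (λ i → aa i (next i)) aa₂ ⟩
        ∑[ i < 3 ] aa i (next i) + ∑[ i < 3 ] aa₂ i
          -- The pairs leading from `A ∪ B` of a chain to `A ∪ B` of the next are transferred to the
          -- share of the latter.
          ≡⟨ cong (_+ ∑[ i < 3 ] aa₂ i) (∑-prev aa) ⟩
        ∑[ i < 3 ] aa₁ i + ∑[ i < 3 ] aa₂ i
          ≡⟨ ∑-distrib-+ {3} aa₁ aa₂ ⟨
        ∑[ i < 3 ] (aa₁ i + aa₂ i) ∎
        where
        open +-*-Solver
        x+[y+z]≡y+[x+z] : ∀ x y z → x + (y + z) ≡ y + (x + z)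
        x+[y+z]≡y+[x+z] = solve 3 (λ x y z → x :+ (y :+ z) := y :+ (x :+ z)) refl
      ca-sum : ∑∑ ca ≡ ∑[ i < 3 ] ca₁ i
      ca-sum = trans (∑-comm {3} {3} ca) (∑∑-cyclic (λ l l′ → ca l′ l))
      regroup : ∀ i → ((aa₁ i + aa₂ i) + ac₁ i) + ca₁ i ≡ perChain i
      regroup i = trans
        (solve 9 (λ p q r a b d x y z → ((p :+ (q :+ r)) :+ (a :+ (b :+ d))) :+ (x :+ (y :+ z))
            := q :+ ((a :+ (r :+ d)) :+ ((x :+ (p :+ z)) :+ (b :+ y)))) refl
          (aa₁ i) (aa i i) (aa i (next (next i))) (ac i i) (ac i (next i)) (ac i (next (next i)))
          (ca i i) (ca (next i) i) (ca (next (next i)) i))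
        (cong (aa i i +_) (cong₂ _+_ (sym (N-others (AB i) i (next (next i))))
          (cong (_+ (ac i (next i) + ca (next i) i)) (sym (others-N (AB i) i (next (next i)))))))
        where open +-*-Solver

    -- Evaluation of the sums

    deep shallow deepC : ℕ
    deep    = ∑[ r < 3 * m ] (suc k ∸ (4 * m + toℕ r))
    shallow = ∑[ r < 3 * m ] (suc k ∸ toℕ r)
    deepC   = ∑[ t < m ] (suc k ∸ (3 * m + toℕ t))

    -- Since `k + 1 - 4m ≤ m`, every range of length at least `m` contains all solutions `t`. The
    -- range `3m` of the own chain and the range `5m` of the far points thus give the same value.
    ∑∑-deep : ∀ n → m ≤ n → ∑[ r < 3 * m ] ∑[ t < n ] 𝟙 ((4 * m + toℕ r) + toℕ t ≤? k) ≡ deep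
    ∑∑-deep n m≤n = sum-cong-≗ {3 * m} λ r → ∑-+≤ (4 * m + toℕ r) k n
      (≤-trans (∸-mono k<5m (m≤m+n (4 * m) (toℕ r)))
        (≤-trans (≤-reflexive (m+n∸n≡m m (4 * m))) m≤n))

    ∑∑-shallow : ∑[ r < 3 * m ] ∑[ t < m + (3 * m + m) ] 𝟙 (toℕ r + toℕ t ≤? k) ≡ shallow
    ∑∑-shallow = sum-cong-≗ {3 * m} λ r → ∑-+≤ (toℕ r) k (m + (3 * m + m))
      (≤-trans (m∸n≤m (suc k) (toℕ r))
        (≤-trans k<5m (≤-reflexive (cong (m +_) (+-comm m (3 * m))))))

    ∑∑-deepC : ∑[ r < 3 * m ] ∑[ t < m ] 𝟙 ((3 * m + toℕ r) + toℕ t ≤? k) ≡ deepC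
    -- The sums are exchanged because, for fixed `r`, the solutions `t` may exceed the range `m`,
    -- whereas for fixed `t` there are at most `2m` solutions `r`, all within the range `3m`.
    ∑∑-deepC = trans (∑-comm {3 * m} {m} (λ r t → 𝟙 ((3 * m + toℕ r) + toℕ t ≤? k)))
      (sum-cong-≗ {m} λ t → trans
        (sum-cong-≗ {3 * m} λ r → cong (λ x → 𝟙 (x ≤? k)) (x+y+z≡x+z+y (3 * m) (toℕ r) (toℕ t)))
        (∑-+≤ (3 * m + toℕ t) k (3 * m) (≤-trans (∸-mono k<5m (m≤m+n (3 * m) (toℕ t)))
          (≤-trans (≤-reflexive (trans (cong (_∸ 3 * m) (sym (+-assoc m m (3 * m))))
              (m+n∸n≡m (m + m) (3 * m))))
            (+-monoʳ-≤ m (m≤m+n m _))))))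
      where
      open +-*-Solver
      x+y+z≡x+z+y : ∀ x y z → (x + y) + z ≡ (x + z) + y
      x+y+z≡x+z+y = solve 3 (λ x y z → (x :+ y) :+ z := (x :+ z) :+ y) refl

    perChain-value : ∀ i → perChain i ≡ ((shallow + deepC) + deep) + deep
    perChain-value i = trans
      (cong₂ _+_ (trans (N-AB-AB i) (∑∑-deep (3 * m) (m≤m+n m _)))
        (cong₂ _+_ (trans (N-AB-others σ) (∑∑-deep _ (m≤m+n m _)))
          (cong₂ _+_ (trans (N-others-AB σ) ∑∑-shallow)
            (cong₂ _+_ (trans (N-AB-nextC σ) ∑∑-deepC) (N-nextC-AB σ)))))
      (solve 3 (λ d s c → d :+ (d :+ (s :+ (c :+ con 0))) := ((s :+ c) :+ d) :+ d) refl
        deep shallow deepC)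
      where
      open +-*-Solver
      σ = cyclic-next i

    k<3m+m+3m : suc k ≤ (3 * m + m) + 3 * m
    k<3m+m+3m = ≤-trans k<5m (≤-trans (m≤m+n (5 * m) (2 * m)) (≤-reflexive
      (solve 1 (λ m → con 5 :* m :+ con 2 :* m := (con 3 :* m :+ m) :+ con 3 :* m) refl m)))
      where open +-*-Solver

    -- With the terms written as `k + 1 - v`, `shallow` takes `v` from `0` to `3m - 1`, `deepC` from
    -- `3m` to `4m - 1` and `deep` from `4m` to `7m - 1`. They join into one triangular sum,
    -- complete because `k + 1 ≤ 7m`.
    all-levels : (shallow + deepC) + deep ≡ (k + 2) C 2
    all-levels = begin
      (shallow + deepC) + deep
        ≡⟨ cong (_+ deep) (cong₂ _+_
             (sum-cong-≗ {3 * m} λ r → cong (suc k ∸_) (sym (Finₚ.toℕ-↑ˡ r m)))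
             (sum-cong-≗ {m} λ t → cong (suc k ∸_) (sym (Finₚ.toℕ-↑ʳ (3 * m) t)))) ⟩
      (∑[ r < 3 * m ] level (r ↑ˡ m) + ∑[ t < m ] level ((3 * m) ↑ʳ t)) + deep
        ≡⟨ cong (_+ deep) (sum-split (3 * m) {m} level) ⟨
      ∑[ r < 3 * m + m ] level r + deep
        ≡⟨ cong₂ _+_ (sum-cong-≗ {3 * m + m} λ r → cong (suc k ∸_) (sym (Finₚ.toℕ-↑ˡ r (3 * m))))
             (sum-cong-≗ {3 * m} λ t → cong (suc k ∸_) (sym (trans (Finₚ.toℕ-↑ʳ (3 * m + m) t)
               (cong (_+ toℕ t) (+-comm (3 * m) m))))) ⟩
      ∑[ r < 3 * m + m ] level (r ↑ˡ (3 * m)) + ∑[ t < 3 * m ] level ((3 * m + m) ↑ʳ t)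
        ≡⟨ sum-split (3 * m + m) {3 * m} level ⟨
      ∑[ r < (3 * m + m) + 3 * m ] level r
        ≡⟨ ∑-∸ (suc k) ((3 * m + m) + 3 * m) k<3m+m+3m ⟩
      suc (suc k) C 2
        ≡⟨ cong (_C 2) (+-comm 2 k) ⟩
      (k + 2) C 2 ∎
      where
      open ≡-Reasoning
      level : ∀ {n} → Fin n → ℕ
      level r = suc k ∸ toℕ r

    -- This is for the second copy of `deep` in `perChain-value`, a triangular sum of its own once
    -- `4m` is subtracted from `k`.
    deep-levels : 4 * m ≤ k → deep ≡ (k ∸ 4 * m + 2) C 2
    deep-levels 4m≤k = begin
      deep
        ≡⟨ sum-cong-≗ {3 * m} (λ r → trans (sym (∸-+-assoc (suc k) (4 * m) (toℕ r)))
             (cong (_∸ toℕ r) (+-∸-assoc 1 4m≤k))) ⟩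
      ∑[ r < 3 * m ] (suc (k ∸ 4 * m) ∸ toℕ r)
        ≡⟨ ∑-∸ (suc (k ∸ 4 * m)) (3 * m) (≤-trans (≤-reflexive (sym (+-∸-assoc 1 4m≤k)))
             (≤-trans (∸-monoˡ-≤ (4 * m) k<5m)
               (≤-trans (≤-reflexive (m+n∸n≡m m (4 * m))) (m≤m+n m _)))) ⟩
      suc (suc (k ∸ 4 * m)) C 2
        ≡⟨ cong (_C 2) (+-comm 2 (k ∸ 4 * m)) ⟩
      (k ∸ 4 * m + 2) C 2 ∎
      where open ≡-Reasoning

    E-value : 4 * m ≤ k → E k points ≡ 3 * ((k + 2) C 2) + 3 * ((k ∸ 4 * m + 2) C 2)
    E-value 4m≤k = begin
      E k points
        ≡⟨ E-perChain ⟩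
      ∑[ i < 3 ] perChain i
        ≡⟨ sum-cong-≗ {3} perChain-value ⟩
      3 * (((shallow + deepC) + deep) + deep)
        ≡⟨ cong (3 *_) (cong₂ _+_ all-levels (deep-levels 4m≤k)) ⟩
      3 * ((k + 2) C 2 + (k ∸ 4 * m + 2) C 2)
        ≡⟨ *-distribˡ-+ 3 ((k + 2) C 2) _ ⟩
      3 * ((k + 2) C 2) + 3 * ((k ∸ 4 * m + 2) C 2)  ∎
      where open ≡-Reasoning

-- The known lower bound for n divisible by 3

lowerBoundSum : ∀ a k → a ≤ k → 3 * ((k ∸ a + 2) C 2) ≡ ∑ a k (λ j → 3 * j + 3 ∸ a * 3)
lowerBoundSum a k a≤k = begin
  3 * ((k ∸ a + 2) C 2)
    ≡⟨ cong (λ x → 3 * (x C 2)) (+-comm (k ∸ a) 2) ⟩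
  3 * (suc (suc (k ∸ a)) C 2)
    ≡⟨ cong (3 *_) (∑-suc (suc (k ∸ a))) ⟨
  3 * ∑[ i < suc (k ∸ a) ] suc (toℕ i)
    ≡⟨ *-distribˡ-sum {suc (k ∸ a)} 3 (λ i → suc (toℕ i)) ⟩
  ∑[ i < suc (k ∸ a) ] (3 * suc (toℕ i))
    ≡⟨ sum-cong-≗ {suc (k ∸ a)} (λ i → sym (term (toℕ i))) ⟩
  ∑[ i < suc (k ∸ a) ] (3 * (a + toℕ i) + 3 ∸ a * 3)
    ≡⟨ listSum-applyUpTo (λ i → 3 * (a + i) + 3 ∸ a * 3) id (suc (k ∸ a)) ⟨
  ∑ₗ (suc (k ∸ a))
    ≡⟨ cong ∑ₗ (+-∸-assoc 1 a≤k) ⟨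
  ∑ₗ (suc k ∸ a) ∎
  where
  open ≡-Reasoning
  ∑ₗ : ℕ → ℕ
  ∑ₗ n = listSum (λ i → 3 * (a + i) + 3 ∸ a * 3) (upTo n)
  -- With `j = a + i` the minuend exceeds `a * 3` by `3 * suc i`, so the truncated subtraction is
  -- exact.
  term : ∀ i → 3 * (a + i) + 3 ∸ a * 3 ≡ 3 * suc i
  term i = trans
    (cong (_∸ a * 3) (solve 2 (λ a i →
      con 3 :* (a :+ i) :+ con 3 := con 3 :* (con 1 :+ i) :+ a :* con 3) refl a i))
    (m+n∸n≡m (3 * suc i) (a * 3))
    where open +-*-Solver

theorem10 : ∀ {c ℓ₁ ℓ₂} (F : OrderedField c ℓ₁ ℓ₂) → let open Plane F in
    ∀ (n k : ℕ) → n / 3 ≤ k → suc k ≤ (5 * n) / 12 →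
    (∀ (m : ℕ) → n ≡ 12 * m → (S : ThreeChains m) →
    E k (ThreeChains.points S) ≡ 3 * ((k + 2) C 2) + 3 * ((k ∸ n / 3 + 2) C 2))
    ×
    (3 ∣ n →
    3 * ((k + 2) C 2) + 3 * ((k ∸ n / 3 + 2) C 2)
    ≡ 3 * ((k + 2) C 2) + ∑ (n / 3) k (λ j → 3 * j + 3 ∸ n))
theorem10 F n k n/3≤k k<5n/12 = edges , bound
  where
  open Plane F
  edges : ∀ m → n ≡ 12 * m → (S : ThreeChains m) →
          E k (ThreeChains.points S) ≡ 3 * ((k + 2) C 2) + 3 * ((k ∸ n / 3 + 2) C 2)
  -- Here `5n / 12` is `0`, and no `k` satisfies the upper bound.
  edges zero    refl S = contradiction k<5n/12 λ ()
  -- For `n = 12m` with `m` positive, both quotients are exact and the bounds on `k` become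
  -- `4m ≤ k < 5m`.
  edges (suc m) refl S = subst
    (λ x → E k (ThreeChains.points S) ≡ 3 * ((k + 2) C 2) + 3 * ((k ∸ x + 2) C 2)) (sym n/3≡4m)
    (EdgeCount.Pairs.E-value F m S k (subst (suc k ≤_) 5n/12≡5m k<5n/12)
      (subst (_≤ k) n/3≡4m n/3≤k))
    where
    open +-*-Solver
    n/3≡4m : 12 * suc m / 3 ≡ 4 * suc m
    n/3≡4m = trans (cong (_/ 3) (solve 1 (λ m → con 12 :* m := con 4 :* m :* con 3) refl (suc m)))
      (m*n/n≡m (4 * suc m) 3)
    5n/12≡5m : 5 * (12 * suc m) / 12 ≡ 5 * suc m
    5n/12≡5m = trans
      (cong (_/ 12) (solve 1 (λ m → con 5 :* (con 12 :* m) := con 5 :* m :* con 12) refl (suc m)))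
      (m*n/n≡m (5 * suc m) 12)
  bound : 3 ∣ n → 3 * ((k + 2) C 2) + 3 * ((k ∸ n / 3 + 2) C 2)
          ≡ 3 * ((k + 2) C 2) + ∑ (n / 3) k (λ j → 3 * j + 3 ∸ n)
  bound (divides a refl) = cong (3 * ((k + 2) C 2) +_)
    (subst (λ x → 3 * ((k ∸ x + 2) C 2) ≡ ∑ x k (λ j → 3 * j + 3 ∸ a * 3)) (sym (m*n/n≡m a 3))
      (lowerBoundSum a k (subst (_≤ k) (m*n/n≡m a 3) n/3≤k)))
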